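{- For every $\varepsilon>0$ there are $\delta>0$ and $n_0$ such that every graph $G$ with $n\ge n_0$ vertices and $\lambda_{4,3}(G)\ge\frac12-\delta$ is within edit distance at most $\varepsilon\binom n2$ from $T_{n/2,\,n/2}$ or $2K_{n/2}$.
   Context: Graphs are finite and simple. For a graph $G$ with $n\ge4$ vertices, $\lambda_{4,3}(G)$ is the number of $4$-subsets of $V(G)$ that span exactly $3$ edges of $G$, divided by $\binom n4$. $T_{a,b}$ is the complete bipartite graph with parts of sizes $a$ and $b$, and $2K_{a}$ is the vertex-disjoint union of two cliques with $a$ vertices each; floor/ceiling signs are omitted, so for odd $n$ the two parts (respectively cliques) have sizes $\lfloor n/2\rfloor$ and $\lceil n/2\rceil$. The edit distance between two graphs $G,H$ of the same order is the minimum of $|E(G)\bigtriangleup f(E(H))|$ over bijections $f:V(H)\to V(G)$. -}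

module Defs where

open import Data.Bool.Base using (Bool; true; false; not; _xor_; T)
open import Data.Bool.Properties using (T?)
open import Data.Empty using (⊥)
open import Data.Fin.Base using (Fin; zero; suc; punchIn; punchOut; splitAt)
open import Data.Fin.Properties using (_≟_; _<?_)
open import Data.Fin.Permutation as Perm
  using (Permutation; _⟨$⟩ʳ_; _⟨$⟩ˡ_; insert; remove; insert-remove; cast-id; inverseˡ; inverseʳ)
  renaming (_≈_ to _≈ₚ_)
open import Data.Fin.Subset using (Subset; inside; outside; ∣_∣)
open import Data.Fin.Subset.Properties using (_∈?_)
import Data.Integer.Base as ℤ
open import Data.List.Base
  using (List; []; _∷_; [_]; _++_; length; map; filter; allFin; cartesianProduct; cartesianProductWith)
open import Data.List.Extrema.Nat using (min; min≤v⁺; argmin-all)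
open import Data.List.Membership.Propositional using (lose) renaming (_∈_ to _∈ₗ_)
open import Data.List.Membership.Propositional.Properties
  using (∈-allFin; ∈-cartesianProductWith⁺; ∈-map⁺; ∈-map⁻; ∈-++⁺ˡ; ∈-++⁺ʳ)
open import Data.List.Properties using (filter-≐)
open import Data.List.Relation.Unary.All using ([]; universal)
open import Data.List.Relation.Unary.All.Properties using () renaming (map⁺ to All-map⁺)
open import Data.List.Relation.Unary.AllPairs using ([]; _∷_)
open import Data.List.Relation.Unary.Any using (here)
open import Data.List.Relation.Unary.Unique.Propositional using (Unique)
open import Data.List.Relation.Unary.Unique.Propositional.Properties
  using () renaming (map⁺ to Unique-map⁺; ++⁺ to Unique-++⁺)
open import Data.Nat.Base as ℕ using (ℕ; zero; suc; _+_; _≤_; z≤n; s≤s; NonZero)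
open import Data.Nat.Combinatorics using (_C_; nCk≡nC[n∸k]; nCn≡1; nCk+nC[k+1]≡[n+1]C[k+1])
import Data.Nat.Properties as ℕ
open import Data.Product.Base using (_×_; _,_; ∃; uncurry)
open import Data.Rational.Base using (ℚ; _/_)
open import Data.Sum.Base using (_⊎_; inj₁; inj₂)
open import Data.Vec.Base using ([]; _∷_)
open import Data.Vec.Properties using (∷-injectiveʳ)
open import Relation.Binary.PropositionalEquality
  using (_≡_; refl; sym; trans; cong; cong₂; subst)
open import Relation.Nullary.Decidable using (does; _×-dec_; yes; no; dec-true)

private
  variable
    a b m n : ℕ

record Graph (n : ℕ) : Set where
  field
    adj    : Fin n → Fin n → Bool
    sym-adj : ∀ i j → adj i j ≡ adj j i
    irrefl : ∀ i → adj i i ≡ false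

open Graph public

-- An unordered pair of distinct vertices is represented by its increasing
-- ordering, so each potential edge occurs exactly once.
vertexPairs : ∀ n → List (Fin n × Fin n)
vertexPairs n = filter (uncurry _<?_) (cartesianProduct (allFin n) (allFin n))

edgesSpanned : Graph n → Subset n → ℕ
edgesSpanned {n} G S =
  length (filter (λ (i , j) → (i ∈? S) ×-dec (j ∈? S) ×-dec T? (adj G i j)) (vertexPairs n))

allSubsets : ∀ n → List (Subset n)
allSubsets zero    = [ [] ]
allSubsets (suc n) = map (outside ∷_) (allSubsets n) ++ map (inside ∷_) (allSubsets n)

∈-allSubsets : (S : Subset n) → S ∈ₗ allSubsets n
∈-allSubsets []          = here refl
∈-allSubsets (false ∷ S) = ∈-++⁺ˡ (∈-map⁺ (outside ∷_) (∈-allSubsets S))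
∈-allSubsets {suc n} (true ∷ S) =
  ∈-++⁺ʳ (map (outside ∷_) (allSubsets n)) (∈-map⁺ (inside ∷_) (∈-allSubsets S))

allSubsets-unique : ∀ n → Unique (allSubsets n)
allSubsets-unique zero    = [] ∷ []
allSubsets-unique (suc n) =
  Unique-++⁺ (Unique-map⁺ ∷-injectiveʳ (allSubsets-unique n))
             (Unique-map⁺ ∷-injectiveʳ (allSubsets-unique n))
             λ (p , q) → disjoint (∈-map⁻ (outside ∷_) p) (∈-map⁻ (inside ∷_) q)
  where
  disjoint : ∀ {S : Subset (suc n)} →
             ∃ (λ U → U ∈ₗ allSubsets n × S ≡ outside ∷ U) →
             ∃ (λ U → U ∈ₗ allSubsets n × S ≡ inside ∷ U) → ⊥
  disjoint (_ , _ , refl) (_ , _ , ())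

nCk≢0 : ∀ {n k} → k ≤ n → NonZero (n C k)
nCk≢0 {n} z≤n = subst NonZero (sym (trans (nCk≡nC[n∸k] {0} {n} z≤n) (nCn≡1 n))) _
nCk≢0 {suc n} {suc k} (s≤s k≤n) =
  subst NonZero (nCk+nC[k+1]≡[n+1]C[k+1] n k)
    (ℕ.>-nonZero (ℕ.≤-trans (ℕ.>-nonZero⁻¹ (n C k) {{nCk≢0 k≤n}}) (ℕ.m≤m+n _ _)))

#subsetsSpanning : (k ℓ : ℕ) → Graph n → ℕ
#subsetsSpanning {n} k ℓ G =
  length (filter (λ S → (∣ S ∣ ℕ.≟ k) ×-dec (edgesSpanned G S ℕ.≟ ℓ)) (allSubsets n))

-- λ_{k,ℓ}(G).
Λ : (k ℓ : ℕ) (G : Graph n) → k ≤ n → ℚ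
Λ {n} k ℓ G k≤n = _/_ (ℤ.+ #subsetsSpanning k ℓ G) (n C k) {{nCk≢0 k≤n}}

K : ∀ n → Graph n
K n .adj i j = not (does (i ≟ j))
K n .sym-adj i j with i ≟ j | j ≟ i
... | yes _ | yes _ = refl
... | no  _ | no  _ = refl
... | yes p | no ¬q with () ← ¬q (sym p)
... | no ¬p | yes q with () ← ¬p (sym q)
K n .irrefl i rewrite dec-true (i ≟ i) refl = refl

-- In the next two graphs the first a vertices of Fin (a + b) form one part
-- and the last b vertices the other.

infixr 5 _⊎ᴳ_

_⊎ᴳ_ : Graph a → Graph b → Graph (a + b)
_⊎ᴳ_ {a} {b} G H = record
  { adj     = λ i j → adj⊎ (splitAt a i) (splitAt a j)
  ; sym-adj = λ i j → sym⊎ (splitAt a i) (splitAt a j)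
  ; irrefl  = λ i → irr⊎ (splitAt a i)
  }
  where
  adj⊎ : Fin a ⊎ Fin b → Fin a ⊎ Fin b → Bool
  adj⊎ (inj₁ i) (inj₁ j) = adj G i j
  adj⊎ (inj₂ i) (inj₂ j) = adj H i j
  adj⊎ (inj₁ _) (inj₂ _) = false
  adj⊎ (inj₂ _) (inj₁ _) = false

  sym⊎ : ∀ x y → adj⊎ x y ≡ adj⊎ y x
  sym⊎ (inj₁ i) (inj₁ j) = sym-adj G i j
  sym⊎ (inj₂ i) (inj₂ j) = sym-adj H i j
  sym⊎ (inj₁ _) (inj₂ _) = refl
  sym⊎ (inj₂ _) (inj₁ _) = refl

  irr⊎ : ∀ x → adj⊎ x x ≡ false
  irr⊎ (inj₁ i) = irrefl G i
  irr⊎ (inj₂ i) = irrefl H i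

completeBipartite : ∀ a b → Graph (a + b)
completeBipartite a b = record
  { adj     = λ i j → adj⊎ (splitAt a i) (splitAt a j)
  ; sym-adj = λ i j → sym⊎ (splitAt a i) (splitAt a j)
  ; irrefl  = λ i → irr⊎ (splitAt a i)
  }
  where
  adj⊎ : Fin a ⊎ Fin b → Fin a ⊎ Fin b → Bool
  adj⊎ (inj₁ _) (inj₁ _) = false
  adj⊎ (inj₂ _) (inj₂ _) = false
  adj⊎ (inj₁ _) (inj₂ _) = true
  adj⊎ (inj₂ _) (inj₁ _) = true

  sym⊎ : ∀ x y → adj⊎ x y ≡ adj⊎ y x
  sym⊎ (inj₁ _) (inj₁ _) = refl
  sym⊎ (inj₂ _) (inj₂ _) = refl
  sym⊎ (inj₁ _) (inj₂ _) = refl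
  sym⊎ (inj₂ _) (inj₁ _) = refl

  irr⊎ : ∀ x → adj⊎ x x ≡ false
  irr⊎ (inj₁ _) = refl
  irr⊎ (inj₂ _) = refl

∣_△_∣ : Graph n → Graph n → ℕ
∣_△_∣ {n} G H = length (filter (λ (i , j) → T? (adj G i j xor adj H i j)) (vertexPairs n))

-- The graph whose edge set is f(E(H)).
image : Permutation m n → Graph m → Graph n
image f H .adj i j     = adj H (f ⟨$⟩ˡ i) (f ⟨$⟩ˡ j)
image f H .sym-adj i j = sym-adj H _ _
image f H .irrefl i    = irrefl H _

-- Every bijection occurs up to pointwise equality; see allPerms-complete.
allPerms : ∀ m n → List (Permutation m n)
allPerms zero    zero    = [ Perm.id ]
allPerms (suc m) (suc n) = cartesianProductWith (insert zero) (allFin (suc n)) (allPerms m n)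
allPerms zero    (suc _) = []
allPerms (suc _) zero    = []

-- The first argument of min (its value on the empty list) is itself the cost
-- of a bijection, so the result is the minimum over all bijections.
editDistance : (G : Graph n) (H : Graph m) → m ≡ n → ℕ
editDistance {n} {m} G H m≡n =
  min ∣ G △ image (cast-id m≡n) H ∣ (map (λ f → ∣ G △ image f H ∣) (allPerms m n))

insert-cong : ∀ j {π ρ : Permutation m n} → π ≈ₚ ρ → insert zero j π ≈ₚ insert zero j ρ
insert-cong j π≈ρ k with zero ≟ k
... | yes _ = refl
... | no  p = cong (punchIn j) (π≈ρ (punchOut p))

allPerms-complete : (π : Permutation m n) → ∃ λ ρ → ρ ∈ₗ allPerms m n × ρ ≈ₚ π
allPerms-complete {zero}  {zero}  π = Perm.id , here refl , λ ()
allPerms-complete {zero}  {suc n} π with () ← π ⟨$⟩ˡ zero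
allPerms-complete {suc m} {zero}  π with () ← π ⟨$⟩ʳ zero
allPerms-complete {suc m} {suc n} π
  with ρ , ρ∈ , ρ≈ ← allPerms-complete (remove zero π) =
    insert zero (π ⟨$⟩ʳ zero) ρ
  , ∈-cartesianProductWith⁺ (insert zero) (∈-allFin _) ρ∈
  , λ k → trans (insert-cong (π ⟨$⟩ʳ zero) {ρ} {remove zero π} ρ≈ k) (insert-remove zero π k)

image-cong : (G : Graph n) (H : Graph m) {π ρ : Permutation m n} → π ≈ₚ ρ →
             ∣ G △ image π H ∣ ≡ ∣ G △ image ρ H ∣
image-cong {n} G H {π} {ρ} π≈ρ = cong length
  (filter-≐ (λ (i , j) → T? _) (λ (i , j) → T? _)
    ( (λ {(i , j)} → subst T (eq i j)) , (λ {(i , j)} → subst T (sym (eq i j))) )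
    (vertexPairs n))
  where
  from-cong : ∀ i → π ⟨$⟩ˡ i ≡ ρ ⟨$⟩ˡ i
  from-cong i = trans (sym (inverseˡ ρ))
    (cong (ρ ⟨$⟩ˡ_) (trans (sym (π≈ρ _)) (inverseʳ π)))

  eq : ∀ i j → adj G i j xor adj (image π H) i j ≡ adj G i j xor adj (image ρ H) i j
  eq i j = cong₂ (λ x y → adj G i j xor adj H x y) (from-cong i) (from-cong j)

editDistance-lower : (G : Graph n) (H : Graph m) (m≡n : m ≡ n) (f : Permutation m n) →
                     editDistance G H m≡n ≤ ∣ G △ image f H ∣
editDistance-lower G H m≡n f with ρ , ρ∈ , ρ≈f ← allPerms-complete f =
  min≤v⁺ _ _ (inj₂ (lose (∈-map⁺ _ ρ∈) (ℕ.≤-reflexive (image-cong G H {ρ} {f} ρ≈f))))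

editDistance-attained : (G : Graph n) (H : Graph m) (m≡n : m ≡ n) →
                        ∃ λ (f : Permutation m n) → editDistance G H m≡n ≡ ∣ G △ image f H ∣
editDistance-attained {n} {m} G H m≡n =
  argmin-all (λ x → x) {P = λ d → ∃ λ (f : Permutation m n) → d ≡ ∣ G △ image f H ∣}
    (cast-id m≡n , refl)
    (All-map⁺ (universal (λ f → f , refl) (allPerms m n)))

{-# OPTIONS --safe #-}
module Submission where

-- Put s(x,y) = 1 on edges and s(x,y) = -1 elsewhere, in particular on the diagonal,
-- and c(u,v) = Σ_z s(u,z) s(v,z).  A flag algebra certificate on 6-tuples writes
-- ½ - λ, up to O(1/n), as ½ρ² for the average ρ of s, plus averages over (u,v) of
-- squares, one of which is a multiple of (1 - c(u,v)²/n²)², plus the average of a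
-- function which, symmetrised, is non-negative on all 2¹⁵ sign patterns of a 6-tuple.
-- So if λ is close to ½ then ρ is close to 0 and s(u,z) s(v,z) s(u,w) s(v,w) = 1 for
-- almost all u, v, z, w.  Fixing suitable u and z, s(v,w) = p(v) q(w) for most v, w,
-- where p = s(-,z) and q = s(u,z) s(u,-).  The symmetry of s forces q = σ p up to few
-- vertices for a sign σ, hence s(v,w) = σ p(v) p(w) for most pairs: the graph is close
-- to a complete bipartite graph (σ = -1) or to two disjoint cliques (σ = 1) with parts
-- given by p.  As ρ is close to 0 the parts are almost equal, and moving few vertices
-- makes them equal.

-- If s(u,z) s(v,z) s(u,w) s(v,w) = 1 throughout, all 2×2 minors of the sign matrix s vanish, so s
-- has rank one and, being symmetric, is σ p pᵀ. The two extremal graphs thus form one family, σ =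
-- -1 and σ = 1, and a single argument serves both.
--
-- Sums run over all tuples, repetitions included. A repeated vertex only puts the diagonal value -1
-- at a coordinate, which is again a sign; hence the certificate applies to every tuple and the
-- summed inequality is exact. On the side of λ the O(1/n) enters only when 24·C(n,4) is bounded
-- below by n⁴ - 6n³.
--
-- Fractions and roots are avoided by carrying the precision as integers. Second moments deviate by
-- at most 1/H², averages by at most 1/H (via AM-GM), the sizes of the parts by about 1/κ, where H =
-- 4κ². So δ has order κ⁻⁴, with κ twice the denominator of ε.

-- Multilinear polynomials on the sign cube, and their evaluation at tuples of vertices.

module SignPolynomials where

  open import Data.Bool.Base using (Bool; true; false; _∧_)
  open import Data.Fin.Base using (Fin; zero; suc)
  open import Data.Fin.Patterns
  open import Data.Fin.Properties using (any?; all?) renaming (_≟_ to _≟ᶠ_)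
  import Data.Integer.Base as ℤ
  open import Data.Integer.Base using (ℤ; 0ℤ; 1ℤ; -1ℤ)
  import Data.Integer.Properties as ℤ
  open import Data.Integer.Tactic.RingSolver using (solve-∀)
  open import Data.Nat.Base using (ℕ; zero; suc; z≤n)
  open import Data.Product.Base using (_×_; _,_; proj₁; proj₂; ∃)
  open import Data.Product.Properties using (≡-dec)
  open import Data.Sum.Base using (_⊎_; inj₁; inj₂)
  open import Data.Vec.Base using (Vec; []; _∷_; lookup; map)
  open import Data.Vec.Properties using (lookup-map)
  open import Data.Vec.Relation.Unary.All as All using (All; []; _∷_)
  open import Data.Vec.Relation.Unary.All.Properties using () renaming (map⁺ to All-map⁺)
  open import Relation.Binary.PropositionalEquality
  open import Relation.Nullary.Decidable using (Dec; yes; no; _⊎-dec_; toWitness)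
  open import Relation.Nullary.Negation using (contradiction)

  private variable n : ℕ

  IsSign : ℤ → Set
  IsSign x = x ≡ 1ℤ ⊎ x ≡ -1ℤ

  sign²≡1 : ∀ {x} → IsSign x → x ℤ.* x ≡ 1ℤ
  sign²≡1 (inj₁ refl) = refl
  sign²≡1 (inj₂ refl) = refl

  infixl 6 _+ᴾ_ _-ᴾ_
  infixl 7 _*ᴾ_
  infixr 5 _⊹_

  -- Multilinear polynomials with integer coefficients: p ⊹ q is p + x q for the
  -- first variable x, and 0ᴾ keeps the trees sparse.
  data Poly : ℕ → Set where
    0ᴾ  : Poly n
    con : ℤ → Poly zero
    _⊹_ : Poly n → Poly n → Poly (suc n)

  ⟦_⟧ᴾ : Poly n → Vec ℤ n → ℤ
  ⟦ 0ᴾ ⟧ᴾ    ρ       = 0ℤ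
  ⟦ con z ⟧ᴾ ρ       = z
  ⟦ p ⊹ q ⟧ᴾ (x ∷ ρ) = ⟦ p ⟧ᴾ ρ ℤ.+ x ℤ.* ⟦ q ⟧ᴾ ρ

  const : ℤ → Poly n
  const {zero}  z = con z
  const {suc n} z = const z ⊹ 0ᴾ

  var : Fin n → Poly n
  var zero    = 0ᴾ ⊹ const 1ℤ
  var (suc i) = var i ⊹ 0ᴾ

  negᴾ : Poly n → Poly n
  negᴾ 0ᴾ      = 0ᴾ
  negᴾ (con a) = con (ℤ.- a)
  negᴾ (p ⊹ q) = negᴾ p ⊹ negᴾ q

  _+ᴾ_ _-ᴾ_ _*ᴾ_ : Poly n → Poly n → Poly n
  0ᴾ      +ᴾ r         = r
  con a   +ᴾ 0ᴾ        = con a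
  con a   +ᴾ con b     = con (a ℤ.+ b)
  (p ⊹ q) +ᴾ 0ᴾ        = p ⊹ q
  (p ⊹ q) +ᴾ (p′ ⊹ q′) = p +ᴾ p′ ⊹ q +ᴾ q′

  p -ᴾ q = p +ᴾ negᴾ q

  -- Valid on the cube only, since it uses x² = 1.
  0ᴾ      *ᴾ r         = 0ᴾ
  con a   *ᴾ 0ᴾ        = 0ᴾ
  con a   *ᴾ con b     = con (a ℤ.* b)
  (p ⊹ q) *ᴾ 0ᴾ        = 0ᴾ
  (p ⊹ q) *ᴾ (p′ ⊹ q′) = p *ᴾ p′ +ᴾ q *ᴾ q′ ⊹ p *ᴾ q′ +ᴾ q *ᴾ p′

  isNonNegative : ℤ → Bool
  isNonNegative (ℤ.+ _)    = true
  isNonNegative ℤ.-[1+ _ ] = false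

  -- Setting the first variable to 1 or -1 turns p ⊹ q into p + q or p - q. Substituting in the
  -- normal form, one variable at a time, shares the work between the sign patterns, and an empty
  -- subtree ends a branch at once.
  nonNegativeOnCube : Poly n → Bool
  nonNegativeOnCube 0ᴾ      = true
  nonNegativeOnCube (con z) = isNonNegative z
  nonNegativeOnCube (p ⊹ q) = nonNegativeOnCube (p +ᴾ q) ∧ nonNegativeOnCube (p -ᴾ q)

  const-correct : ∀ z (ρ : Vec ℤ n) → ⟦ const z ⟧ᴾ ρ ≡ z
  const-correct z []      = refl
  const-correct z (x ∷ ρ) = trans (cong₂ ℤ._+_ (const-correct z ρ) (ℤ.*-zeroʳ x)) (ℤ.+-identityʳ z)

  var-correct : ∀ i (ρ : Vec ℤ n) → ⟦ var i ⟧ᴾ ρ ≡ lookup ρ i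
  var-correct zero    (x ∷ ρ) rewrite const-correct 1ℤ ρ = trans (ℤ.+-identityˡ _) (ℤ.*-identityʳ x)
  var-correct (suc i) (x ∷ ρ) rewrite var-correct i ρ | ℤ.*-zeroʳ x = ℤ.+-identityʳ _

  neg-correct : ∀ p (ρ : Vec ℤ n) → ⟦ negᴾ p ⟧ᴾ ρ ≡ ℤ.- ⟦ p ⟧ᴾ ρ
  neg-correct 0ᴾ      ρ       = refl
  neg-correct (con a) ρ       = refl
  neg-correct (p ⊹ q) (x ∷ ρ) rewrite neg-correct p ρ | neg-correct q ρ = lemma (⟦ p ⟧ᴾ ρ) x (⟦ q ⟧ᴾ ρ)
    where
    lemma : ∀ p x q → ℤ.- p ℤ.+ x ℤ.* (ℤ.- q) ≡ ℤ.- (p ℤ.+ x ℤ.* q)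
    lemma = solve-∀

  +-correct : ∀ p q (ρ : Vec ℤ n) → ⟦ p +ᴾ q ⟧ᴾ ρ ≡ ⟦ p ⟧ᴾ ρ ℤ.+ ⟦ q ⟧ᴾ ρ
  +-correct 0ᴾ      r         ρ       = sym (ℤ.+-identityˡ _)
  +-correct (con a) 0ᴾ        ρ       = sym (ℤ.+-identityʳ a)
  +-correct (con a) (con b)   ρ       = refl
  +-correct (p ⊹ q) 0ᴾ        (x ∷ ρ) = sym (ℤ.+-identityʳ _)
  +-correct (p ⊹ q) (p′ ⊹ q′) (x ∷ ρ) rewrite +-correct p p′ ρ | +-correct q q′ ρ =
    lemma (⟦ p ⟧ᴾ ρ) (⟦ p′ ⟧ᴾ ρ) x (⟦ q ⟧ᴾ ρ) (⟦ q′ ⟧ᴾ ρ)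
    where
    lemma : ∀ p p′ x q q′ →
            p ℤ.+ p′ ℤ.+ x ℤ.* (q ℤ.+ q′) ≡ p ℤ.+ x ℤ.* q ℤ.+ (p′ ℤ.+ x ℤ.* q′)
    lemma = solve-∀

  minus-correct : ∀ p q (ρ : Vec ℤ n) → ⟦ p -ᴾ q ⟧ᴾ ρ ≡ ⟦ p ⟧ᴾ ρ ℤ.- ⟦ q ⟧ᴾ ρ
  minus-correct p q ρ = trans (+-correct p (negᴾ q) ρ) (cong (λ z → ⟦ p ⟧ᴾ ρ ℤ.+ z) (neg-correct q ρ))

  *-correct : ∀ p q {ρ : Vec ℤ n} → All IsSign ρ → ⟦ p *ᴾ q ⟧ᴾ ρ ≡ ⟦ p ⟧ᴾ ρ ℤ.* ⟦ q ⟧ᴾ ρ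
  *-correct 0ᴾ      r         σ       = refl
  *-correct (con a) 0ᴾ        σ       = sym (ℤ.*-zeroʳ a)
  *-correct (con a) (con b)   σ       = refl
  *-correct (p ⊹ q) 0ᴾ {x ∷ ρ} σ      = sym (ℤ.*-zeroʳ (⟦ p ⊹ q ⟧ᴾ (x ∷ ρ)))
  *-correct (p ⊹ q) (p′ ⊹ q′) {x ∷ ρ} (sx ∷ σ)
    rewrite +-correct (p *ᴾ p′) (q *ᴾ q′) ρ | +-correct (p *ᴾ q′) (q *ᴾ p′) ρ
          | *-correct p p′ σ | *-correct q q′ σ | *-correct p q′ σ | *-correct q p′ σ =
    trans (cong (λ t → P ℤ.* P′ ℤ.+ t ℤ.+ x ℤ.* (P ℤ.* Q′ ℤ.+ Q ℤ.* P′))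
                (trans (sym (ℤ.*-identityˡ _)) (cong (ℤ._* (Q ℤ.* Q′)) (sym (sign²≡1 sx)))))
          (lemma P P′ x Q Q′)
    where
    P = ⟦ p ⟧ᴾ ρ; P′ = ⟦ p′ ⟧ᴾ ρ; Q = ⟦ q ⟧ᴾ ρ; Q′ = ⟦ q′ ⟧ᴾ ρ
    lemma : ∀ p p′ x q q′ →
            p ℤ.* p′ ℤ.+ x ℤ.* x ℤ.* (q ℤ.* q′) ℤ.+ x ℤ.* (p ℤ.* q′ ℤ.+ q ℤ.* p′)
            ≡ (p ℤ.+ x ℤ.* q) ℤ.* (p′ ℤ.+ x ℤ.* q′)
    lemma = solve-∀

  ∧-true : ∀ {a b} → a ∧ b ≡ true → a ≡ true × b ≡ true
  ∧-true {true} {true} refl = refl , refl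

  nonNegativeOnCube-sound : ∀ (p : Poly n) → nonNegativeOnCube p ≡ true →
                            ∀ {ρ} → All IsSign ρ → 0ℤ ℤ.≤ ⟦ p ⟧ᴾ ρ
  nonNegativeOnCube-sound 0ᴾ            _  _ = ℤ.≤-refl
  nonNegativeOnCube-sound (con (ℤ.+ _)) _  _ = ℤ.+≤+ z≤n
  nonNegativeOnCube-sound (p ⊹ q)       eq {x ∷ ρ} (inj₁ refl ∷ σ) =
    subst (0ℤ ℤ.≤_) (trans (+-correct p q ρ) (cong (λ z → ⟦ p ⟧ᴾ ρ ℤ.+ z) (sym (ℤ.*-identityˡ _))))
      (nonNegativeOnCube-sound (p +ᴾ q) (proj₁ (∧-true eq)) σ)
  nonNegativeOnCube-sound (p ⊹ q)       eq {x ∷ ρ} (inj₂ refl ∷ σ) =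
    subst (0ℤ ℤ.≤_) (trans (minus-correct p q ρ) (cong (λ z → ⟦ p ⟧ᴾ ρ ℤ.+ z) (sym (ℤ.-1*i≡-i _))))
      (nonNegativeOnCube-sound (p -ᴾ q) (proj₂ (∧-true {nonNegativeOnCube (p +ᴾ q)} eq)) σ)

  infixl 6 _⊕_ _⊖_
  infixl 7 _⊗_

  -- Polynomials in the signs s(xᵢ, xⱼ) of the pairs of a 6-tuple x.
  data Expr : Set where
    K           : ℤ → Expr
    edge        : Fin 6 → Fin 6 → Expr
    _⊕_ _⊖_ _⊗_ : Expr → Expr → Expr

  rename : (Fin 6 → Fin 6) → Expr → Expr
  rename π (K z)      = K z
  rename π (edge i j) = edge (π i) (π j)
  rename π (e ⊕ f)    = rename π e ⊕ rename π f
  rename π (e ⊖ f)    = rename π e ⊖ rename π f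
  rename π (e ⊗ f)    = rename π e ⊗ rename π f

  pairs : Vec (Fin 6 × Fin 6) 15
  pairs = (0F , 1F) ∷ (0F , 2F) ∷ (0F , 3F) ∷ (0F , 4F) ∷ (0F , 5F)
        ∷ (1F , 2F) ∷ (1F , 3F) ∷ (1F , 4F) ∷ (1F , 5F)
        ∷ (2F , 3F) ∷ (2F , 4F) ∷ (2F , 5F)
        ∷ (3F , 4F) ∷ (3F , 5F) ∷ (4F , 5F) ∷ []

  Located : Fin 6 → Fin 6 → Set
  Located i j = i ≡ j ⊎ ∃ λ k → lookup pairs k ≡ (i , j) ⊎ lookup pairs k ≡ (j , i)

  locate : ∀ i j → Dec (Located i j)
  locate i j = (i ≟ᶠ j) ⊎-dec any? λ k →
    ≡-dec _≟ᶠ_ _≟ᶠ_ (lookup pairs k) (i , j) ⊎-dec ≡-dec _≟ᶠ_ _≟ᶠ_ (lookup pairs k) (j , i)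

  located : ∀ i j → Located i j
  located = toWitness {a? = all? λ i → all? (locate i)} _

  -- Equal positions get the diagonal value -1. The default `0ᴾ` is never reached: `located` checks
  -- all 36 pairs.
  pairPoly : Fin 6 → Fin 6 → Poly 15
  pairPoly i j with locate i j
  ... | yes (inj₁ _)       = const -1ℤ
  ... | yes (inj₂ (k , _)) = var k
  ... | no  _              = 0ᴾ

  norm : Expr → Poly 15
  norm (K z)      = const z
  norm (edge i j) = pairPoly i j
  norm (e ⊕ f)    = norm e +ᴾ norm f
  norm (e ⊖ f)    = norm e -ᴾ norm f
  norm (e ⊗ f)    = norm e *ᴾ norm f

  module Evaluation {V : Set} (s : V → V → ℤ) (s-sign : ∀ x y → IsSign (s x y))
                    (s-sym : ∀ x y → s x y ≡ s y x) (s-diag : ∀ x → s x x ≡ -1ℤ) where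

    opaque
      ⟦_⟧ : Expr → (Fin 6 → V) → ℤ
      ⟦ K z ⟧      x = z
      ⟦ edge i j ⟧ x = s (x i) (x j)
      ⟦ e ⊕ f ⟧    x = ⟦ e ⟧ x ℤ.+ ⟦ f ⟧ x
      ⟦ e ⊖ f ⟧    x = ⟦ e ⟧ x ℤ.- ⟦ f ⟧ x
      ⟦ e ⊗ f ⟧    x = ⟦ e ⟧ x ℤ.* ⟦ f ⟧ x

      ⟦K⟧ : ∀ z x → ⟦ K z ⟧ x ≡ z
      ⟦K⟧ z x = refl

      ⟦edge⟧ : ∀ i j x → ⟦ edge i j ⟧ x ≡ s (x i) (x j)
      ⟦edge⟧ i j x = refl

      ⟦⊕⟧ : ∀ e f x → ⟦ e ⊕ f ⟧ x ≡ ⟦ e ⟧ x ℤ.+ ⟦ f ⟧ x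
      ⟦⊕⟧ e f x = refl

      ⟦⊖⟧ : ∀ e f x → ⟦ e ⊖ f ⟧ x ≡ ⟦ e ⟧ x ℤ.- ⟦ f ⟧ x
      ⟦⊖⟧ e f x = refl

      ⟦⊗⟧ : ∀ e f x → ⟦ e ⊗ f ⟧ x ≡ ⟦ e ⟧ x ℤ.* ⟦ f ⟧ x
      ⟦⊗⟧ e f x = refl

      ⟦⟧-cong : ∀ e {x y} → (∀ i → x i ≡ y i) → ⟦ e ⟧ x ≡ ⟦ e ⟧ y
      ⟦⟧-cong (K z)      x≗y = refl
      ⟦⟧-cong (edge i j) x≗y = cong₂ s (x≗y i) (x≗y j)
      ⟦⟧-cong (e ⊕ f)    x≗y = cong₂ ℤ._+_ (⟦⟧-cong e x≗y) (⟦⟧-cong f x≗y)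
      ⟦⟧-cong (e ⊖ f)    x≗y = cong₂ ℤ._-_ (⟦⟧-cong e x≗y) (⟦⟧-cong f x≗y)
      ⟦⟧-cong (e ⊗ f)    x≗y = cong₂ ℤ._*_ (⟦⟧-cong e x≗y) (⟦⟧-cong f x≗y)

      ⟦⟧-rename : ∀ π e x → ⟦ rename π e ⟧ x ≡ ⟦ e ⟧ (λ i → x (π i))
      ⟦⟧-rename π (K z)      x = refl
      ⟦⟧-rename π (edge i j) x = refl
      ⟦⟧-rename π (e ⊕ f)    x = cong₂ ℤ._+_ (⟦⟧-rename π e x) (⟦⟧-rename π f x)
      ⟦⟧-rename π (e ⊖ f)    x = cong₂ ℤ._-_ (⟦⟧-rename π e x) (⟦⟧-rename π f x)
      ⟦⟧-rename π (e ⊗ f)    x = cong₂ ℤ._*_ (⟦⟧-rename π e x) (⟦⟧-rename π f x)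

    module _ (x : Fin 6 → V) where

      pairSign : Fin 6 × Fin 6 → ℤ
      pairSign (i , j) = s (x i) (x j)

      signs : Vec ℤ 15
      signs = map pairSign pairs

      signs-sign : All IsSign signs
      signs-sign = All-map⁺ (All.universal (λ (i , j) → s-sign (x i) (x j)) pairs)

      pairPoly-correct : ∀ i j → ⟦ pairPoly i j ⟧ᴾ signs ≡ s (x i) (x j)
      pairPoly-correct i j with locate i j
      ... | yes (inj₁ refl) = trans (const-correct -1ℤ signs) (sym (s-diag (x i)))
      ... | yes (inj₂ (k , eq)) = trans (var-correct k signs)
                                    (trans (lookup-map k pairSign pairs) (orient eq))
        where
        orient : lookup pairs k ≡ (i , j) ⊎ lookup pairs k ≡ (j , i) →
                 pairSign (lookup pairs k) ≡ s (x i) (x j)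
        orient (inj₁ eq) = cong pairSign eq
        orient (inj₂ eq) = trans (cong pairSign eq) (s-sym _ _)
      ... | no ¬l = contradiction (located i j) ¬l

      opaque
       unfolding ⟦_⟧
       norm-correct : ∀ e → ⟦ norm e ⟧ᴾ signs ≡ ⟦ e ⟧ x
       norm-correct (K z)      = const-correct z signs
       norm-correct (edge i j) = pairPoly-correct i j
       norm-correct (e ⊕ f)    = trans (+-correct (norm e) (norm f) signs)
                                   (cong₂ ℤ._+_ (norm-correct e) (norm-correct f))
       norm-correct (e ⊖ f)    = trans (minus-correct (norm e) (norm f) signs)
                                   (cong₂ ℤ._-_ (norm-correct e) (norm-correct f))
       norm-correct (e ⊗ f)    = trans (*-correct (norm e) (norm f) signs-sign)
                                   (cong₂ ℤ._*_ (norm-correct e) (norm-correct f))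

      -- The tuple x may repeat vertices, since `signs x` is a point of the cube in any case. This
      -- is what allows summation over all tuples later.
      expr-nonNegative : ∀ e → nonNegativeOnCube (norm e) ≡ true → 0ℤ ℤ.≤ ⟦ e ⟧ x
      expr-nonNegative e eq =
        subst (0ℤ ℤ.≤_) (norm-correct e) (nonNegativeOnCube-sound (norm e) eq signs-sign)

-- The flag algebra certificate as a polynomial in fifteen signs.

module Certificate where

  open import Data.Fin.Base using (Fin)
  open import Data.Fin.Patterns
  open import Data.Bool.Base using (true)
  open import Data.Integer.Base using (+_; 0ℤ; 1ℤ)
  open import Data.List.Base using (List; []; _∷_; _++_; map; cartesianProductWith)
  open import Relation.Binary.PropositionalEquality
  open SignPolynomials

  variable
    A B : Set

  Fn : Set → Set → Set
  Fn A B = A → A → A → A → A → A → B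

  -- Adjacent transpositions generate all reorderings, so the invariance of a sixfold sum reduces to
  -- interchanging two neighbouring sums.
  swapArgs : Fin 5 → Fn A B → Fn A B
  swapArgs 0F f a b c d e g = f b a c d e g
  swapArgs 1F f a b c d e g = f a c b d e g
  swapArgs 2F f a b c d e g = f a b d c e g
  swapArgs 3F f a b c d e g = f a b c e d g
  swapArgs 4F f a b c d e g = f a b c d g e

  permuteArgs : List (Fin 5) → Fn A B → Fn A B
  permuteArgs []      f = f
  permuteArgs (i ∷ w) f = swapArgs i (permuteArgs w f)

  -- Representatives of the 45 ways to write {0,…,5} as {u,v} ∪ {z,w} ∪ {z′,w′}
  -- with {z,w} and {z′,w′} unordered.
  splits : List (List (Fin 5))
  splits = cartesianProductWith _++_
    ( []
    ∷ (1F ∷ [])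
    ∷ (2F ∷ 1F ∷ [])
    ∷ (3F ∷ 2F ∷ 1F ∷ [])
    ∷ (4F ∷ 3F ∷ 2F ∷ 1F ∷ [])
    ∷ (0F ∷ 1F ∷ [])
    ∷ (0F ∷ 2F ∷ 1F ∷ [])
    ∷ (0F ∷ 3F ∷ 2F ∷ 1F ∷ [])
    ∷ (0F ∷ 4F ∷ 3F ∷ 2F ∷ 1F ∷ [])
    ∷ (1F ∷ 0F ∷ 2F ∷ 1F ∷ [])
    ∷ (1F ∷ 0F ∷ 3F ∷ 2F ∷ 1F ∷ [])
    ∷ (1F ∷ 0F ∷ 4F ∷ 3F ∷ 2F ∷ 1F ∷ [])
    ∷ (2F ∷ 1F ∷ 0F ∷ 3F ∷ 2F ∷ 1F ∷ [])
    ∷ (2F ∷ 1F ∷ 0F ∷ 4F ∷ 3F ∷ 2F ∷ 1F ∷ [])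
    ∷ (3F ∷ 2F ∷ 1F ∷ 0F ∷ 4F ∷ 3F ∷ 2F ∷ 1F ∷ [])
    ∷ [])
    ([] ∷ (3F ∷ []) ∷ (4F ∷ 3F ∷ []) ∷ [])

  Flag : Set
  Flag = (s a b c d e : Expr) → Expr

  -- The arguments stand for s(u,v), s(u,z), s(v,z), s(u,w), s(v,w), s(z,w).  The averages
  -- of flag₁, flag₂, flag₃ over z, w vanish up to O(1/n) on complete bipartite graphs and on
  -- unions of two cliques; the coefficients are a rounded solution of a semidefinite program.
  flag₁ flag₂ flag₃ cycleFlag : Flag
  flag₁ s a b c d e =
      (K (+ 25) ⊗ s ⊕ K (+ 16) ⊗ e) ⊗ (b ⊕ d ⊖ a ⊖ c)
    ⊕ (K (+ 4) ⊖ K (+ 12) ⊗ e ⊗ s) ⊗ (b ⊗ d ⊖ a ⊗ c)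
    ⊕ (K (+ 2) ⊗ s ⊖ K (+ 7) ⊗ e) ⊗ (b ⊗ d ⊗ (a ⊕ c) ⊖ a ⊗ c ⊗ (b ⊕ d))
  flag₂ s a b c d e =
      (K (+ 20) ⊗ e ⊖ K (+ 30) ⊗ s) ⊗ (a ⊕ b ⊕ c ⊕ d)
    ⊖ K (+ 4) ⊗ ((a ⊕ b) ⊗ (c ⊕ d) ⊖ e ⊗ s ⊗ (a ⊗ b ⊕ c ⊗ d) ⊖ K (+ 2) ⊗ e ⊗ s)
    ⊖ K (+ 4) ⊗ (e ⊗ s ⊗ (a ⊕ b) ⊗ (c ⊕ d) ⊖ (a ⊗ b ⊕ c ⊗ d) ⊖ K (+ 2))
    ⊕ (K (+ 8) ⊗ e ⊕ K (+ 2) ⊗ s) ⊗ (a ⊗ b ⊗ (c ⊕ d) ⊕ c ⊗ d ⊗ (a ⊕ b))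
    ⊕ (K (+ 4) ⊗ e ⊗ s ⊕ K (+ 6)) ⊗ (a ⊗ b ⊗ c ⊗ d ⊖ K 1ℤ)
  flag₃ s a b c d e =
      K (+ 10) ⊗ s ⊗ (a ⊕ b ⊕ c ⊕ d)
    ⊕ K (+ 17) ⊗ ((a ⊕ b) ⊗ (c ⊕ d) ⊖ e ⊗ s ⊗ (a ⊗ b ⊕ c ⊗ d) ⊖ K (+ 2) ⊗ e ⊗ s)
    ⊖ K (+ 4) ⊗ (e ⊗ s ⊗ (a ⊕ b) ⊗ (c ⊕ d) ⊖ (a ⊗ b ⊕ c ⊗ d) ⊖ K (+ 2))
    ⊕ (K (+ 2) ⊗ e ⊖ K (+ 12) ⊗ s) ⊗ (a ⊗ b ⊗ (c ⊕ d) ⊕ c ⊗ d ⊗ (a ⊕ b))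
    ⊕ (K (+ 40) ⊗ e ⊗ s ⊖ K (+ 14)) ⊗ (a ⊗ b ⊗ c ⊗ d ⊖ K 1ℤ)
  cycleFlag s a b c d e = K 1ℤ ⊖ a ⊗ b ⊗ c ⊗ d

  onEdges : Flag → (u v z w : Fin 6) → Expr
  onEdges f u v z w = f (edge u v) (edge u z) (edge v z) (edge u w) (edge v w) (edge z w)

  flagProduct : Flag → Fn (Fin 6) Expr
  flagProduct f u v z w z′ w′ = onEdges f u v z w ⊗ onEdges f u v z′ w′

  -- On signs this is 32 if exactly three of them are 1, and 0 otherwise.
  threeOfSix : (a b c d e f : Expr) → Expr
  threeOfSix a b c d e f =
      (K (+ 16) ⊖ (a ⊕ b ⊕ c ⊕ d ⊕ e ⊕ f) ⊗ (a ⊕ b ⊕ c ⊕ d ⊕ e ⊕ f))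
    ⊗ (K 1ℤ ⊖ a ⊗ b ⊗ c ⊗ d ⊗ e ⊗ f)

  threeAmong : (z w z′ w′ : Fin 6) → Expr
  threeAmong z w z′ w′ =
    threeOfSix (edge z w) (edge z z′) (edge z w′) (edge w z′) (edge w w′) (edge z′ w′)

  -- Since 33856 = 16 · 2116 and a quadruple with three edges weighs 32, the first two terms average
  -- to 32 · 2116 · (½ - ½ρ² - λ) up to O(1/n). In each product the two factors involve the disjoint
  -- pairs (z,w) and (z′,w′), so for fixed u, v it sums to a square.
  slack : Fn (Fin 6) Expr
  slack u v z w z′ w′ =
      K (+ 33856) ⊗ (K 1ℤ ⊖ edge z w ⊗ edge z′ w′)
    ⊖ K (+ 2116) ⊗ threeAmong z w z′ w′
    ⊖ K (+ 8) ⊗ flagProduct flag₁ u v z w z′ w′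
    ⊖ K (+ 2) ⊗ flagProduct flag₂ u v z w z′ w′
    ⊖ flagProduct flag₃ u v z w z′ w′
    ⊖ K (+ 16) ⊗ flagProduct cycleFlag u v z w z′ w′

  sumᴱ : List Expr → Expr
  sumᴱ []       = K 0ℤ
  sumᴱ (e ∷ es) = e ⊕ sumᴱ es

  symmetrised : Fn (Fin 6) Expr → List (List (Fin 5)) → Expr
  symmetrised f ws = sumᴱ (map (λ w → permuteArgs w f 0F 1F 2F 3F 4F 5F) ws)

  -- The whole numerical content of the certificate, verified by evaluation. Each flag is symmetric
  -- or antisymmetric in u, v and symmetric in z, w, so `slack` is invariant under a group of order
  -- 16, and 720/16 = 45 placements represent the average over all permutations.
  certificate : nonNegativeOnCube (norm (symmetrised slack splits)) ≡ true
  certificate = refl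

-- Finite integer sums, iterated sums and averaging.

module Sums where

  open import Algebra.Bundles using (CommutativeRing)
  open import Data.Fin.Base using (Fin; zero; suc)
  open import Data.Integer.Base using (ℤ; +_; -[1+_]; _+_; _*_; _-_; -_; _≤_; 0ℤ)
  import Data.Integer.Base as ℤ
  import Data.Integer.Properties as ℤ
  open import Data.Integer.Tactic.RingSolver using (solve-∀)
  open import Data.Nat.Base as ℕ using (ℕ; zero; suc)
  open import Data.Product.Base using (_,_; ∃)
  open import Relation.Binary.PropositionalEquality
  open import Relation.Nullary.Decidable using (yes; no)

  import Algebra.Properties.Semiring.Sum (CommutativeRing.semiring ℤ.+-*-commutativeRing) as Sum
  open import Data.Fin.Permutation using (Permutation; _⟨$⟩ʳ_)

  private variable m n : ℕ

  opaque
    sum : (Fin n → ℤ) → ℤ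
    sum = Sum.sum

    sum-zero : (f : Fin 0 → ℤ) → sum f ≡ 0ℤ
    sum-zero f = refl

    sum-suc : (f : Fin (suc n) → ℤ) → sum f ≡ f zero + sum (λ i → f (suc i))
    sum-suc f = refl

    sum-cong : {f g : Fin n → ℤ} → (∀ i → f i ≡ g i) → sum f ≡ sum g
    sum-cong = Sum.sum-cong-≗

    sum-plus : (f g : Fin n → ℤ) → sum (λ i → f i + g i) ≡ sum f + sum g
    sum-plus = Sum.∑-distrib-+

    sum-comm : (f : Fin m → Fin n → ℤ) →
               sum (λ i → sum (λ j → f i j)) ≡ sum (λ j → sum (λ i → f i j))
    sum-comm = Sum.∑-comm

    sum-permute : (f : Fin n → ℤ) (π : Permutation m n) → sum f ≡ sum (λ i → f (π ⟨$⟩ʳ i))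
    sum-permute = Sum.sum-permute

    sum-*ˡ : ∀ c (f : Fin n → ℤ) → sum (λ i → c * f i) ≡ c * sum f
    sum-*ˡ c f = sym (Sum.*-distribˡ-sum c f)

    sum-neg : (f : Fin n → ℤ) → sum (λ i → - f i) ≡ - sum f
    sum-neg {zero}  f = refl
    sum-neg {suc n} f = trans (cong (λ z → - f zero + z) (sum-neg (λ i → f (suc i))))
                              (sym (ℤ.neg-distrib-+ (f zero) _))

    sum-const : ∀ n c → sum {n} (λ _ → c) ≡ + n * c
    sum-const zero    c = refl
    sum-const (suc n) c = trans (cong (λ z → c + z) (sum-const n c)) (sym (ℤ.suc-* (+ n) c))

    sum-mono : {f g : Fin n → ℤ} → (∀ i → f i ≤ g i) → sum f ≤ sum g
    sum-mono {zero}  f≤g = ℤ.≤-refl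
    sum-mono {suc n} f≤g = ℤ.+-mono-≤ (f≤g zero) (sum-mono (λ i → f≤g (suc i)))

  sum-minus : (f g : Fin n → ℤ) → sum (λ i → f i - g i) ≡ sum f - sum g
  sum-minus f g = trans (sum-plus f (λ i → - g i)) (cong (λ z → sum f + z) (sum-neg g))

  sum-nonNegative : {f : Fin n → ℤ} → (∀ i → 0ℤ ≤ f i) → 0ℤ ≤ sum f
  sum-nonNegative {n} {f} 0≤f = subst (_≤ sum f) (trans (sum-const n 0ℤ) (ℤ.*-zeroʳ (+ n)))
      (sum-mono 0≤f)

  square-nonNegative : ∀ i → 0ℤ ≤ i * i
  square-nonNegative (+ n)      = subst (0ℤ ≤_) (ℤ.pos-* n n) (ℤ.+≤+ ℕ.z≤n)
  square-nonNegative -[1+ n ]  = ℤ.+≤+ ℕ.z≤n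

  +-cancelˡ-≤ : ∀ i {j k} → i + j ≤ i + k → j ≤ k
  +-cancelˡ-≤ i {j} {k} le = subst₂ _≤_ (lemma i j) (lemma i k) (ℤ.+-monoʳ-≤ (- i) le)
    where
    lemma : ∀ i j → - i + (i + j) ≡ j
    lemma = solve-∀

  exists-≤-average′ : ∀ n (f : Fin (suc n) → ℤ) (c : ℤ) → sum f ≤ + suc n * c → ∃ λ i → f i ≤ c
  exists-≤-average′ zero    f c le =
    zero , subst₂ _≤_ (trans (sum-suc f) (trans (cong (λ z → f zero + z) (sum-zero _))
        (ℤ.+-identityʳ (f zero)))) (ℤ.*-identityˡ c) le
  exists-≤-average′ (suc n) f c le with f zero ℤ.≤? c
  ... | yes f₀≤c = zero , f₀≤c
  ... | no  f₀≰c = let i , fi≤c = exists-≤-average′ n (λ i → f (suc i)) c rest in suc i , fi≤c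
    where
    rest : sum (λ i → f (suc i)) ≤ + suc n * c
    rest = +-cancelˡ-≤ c (ℤ.≤-trans (ℤ.+-monoˡ-≤ _ (ℤ.<⇒≤ (ℤ.≰⇒> f₀≰c)))
      (subst₂ _≤_ (sum-suc f) (ℤ.suc-* (+ suc n) c) le))

  exists-≤-average : ∀ n .{{_ : ℕ.NonZero n}} (f : Fin n → ℤ) (c : ℤ) → sum f ≤ + n * c → ∃ λ i → f
      i ≤ c
  exists-≤-average (suc n) = exists-≤-average′ n

  sum² : (Fin m → Fin n → ℤ) → ℤ
  sum² f = sum λ a → sum λ b → f a b

  sum²-cong : {f g : Fin m → Fin n → ℤ} → (∀ a b → f a b ≡ g a b) → sum² f ≡ sum² g
  sum²-cong f≗g = sum-cong λ a → sum-cong (f≗g a)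

  sum²-mono : {f g : Fin m → Fin n → ℤ} → (∀ a b → f a b ≤ g a b) → sum² f ≤ sum² g
  sum²-mono f≤g = sum-mono λ a → sum-mono (f≤g a)

  sum²-plus : (f g : Fin m → Fin n → ℤ) → sum² (λ a b → f a b + g a b) ≡ sum² f + sum² g
  sum²-plus f g = trans (sum-cong λ a → sum-plus (f a) (g a)) (sum-plus _ (λ a → sum (g a)))

  sum²-minus : (f g : Fin m → Fin n → ℤ) → sum² (λ a b → f a b - g a b) ≡ sum² f - sum² g
  sum²-minus f g = trans (sum-cong λ a → sum-minus (f a) (g a)) (sum-minus _ (λ a → sum (g a)))

  sum²-*ˡ : ∀ c (f : Fin m → Fin n → ℤ) → sum² (λ a b → c * f a b) ≡ c * sum² f
  sum²-*ˡ c f = trans (sum-cong λ a → sum-*ˡ c (f a)) (sum-*ˡ c (λ a → sum (f a)))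

  sum²-const : ∀ m n c → sum² {m} {n} (λ _ _ → c) ≡ + m * (+ n * c)
  sum²-const m n c = trans (sum-cong {m} λ _ → sum-const n c) (sum-const m (+ n * c))

  sum²-* : (f g : Fin n → Fin n → ℤ) →
           sum² (λ a b → sum² (λ c d → f a b * g c d)) ≡ sum² f * sum² g
  sum²-* f g = trans (sum²-cong λ a b → sum²-*ˡ (f a b) g)
    (trans (sum²-cong λ a b → ℤ.*-comm (f a b) (sum² g))
      (trans (sum²-*ˡ (sum² g) f) (ℤ.*-comm (sum² g) (sum² f))))

  sum⁴ : (Fin n → Fin n → Fin n → Fin n → ℤ) → ℤ
  sum⁴ f = sum² λ a b → sum² (f a b)

  sum⁴-minus : (f g : Fin n → Fin n → Fin n → Fin n → ℤ) →
               sum⁴ (λ a b c d → f a b c d - g a b c d) ≡ sum⁴ f - sum⁴ g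
  sum⁴-minus f g = trans (sum²-cong λ a b → sum²-minus (f a b) (g a b))
      (sum²-minus (λ a b → sum² (f a b)) _)

  sum⁴-*ˡ : ∀ k (f : Fin n → Fin n → Fin n → Fin n → ℤ) →
            sum⁴ (λ a b c d → k * f a b c d) ≡ k * sum⁴ f
  sum⁴-*ˡ k f = trans (sum²-cong λ a b → sum²-*ˡ k (f a b)) (sum²-*ˡ k (λ a b → sum² (f a b)))

  sum²-zero : {f : Fin m → Fin n → ℤ} → (∀ a b → f a b ≡ 0ℤ) → sum² f ≡ 0ℤ
  sum²-zero {m} {n} f≗0 = trans (sum²-cong f≗0) (trans (sum²-const m n 0ℤ)
    (trans (cong (+ m *_) (ℤ.*-zeroʳ (+ n))) (ℤ.*-zeroʳ (+ m))))

-- Summing the certificate over all 6-tuples of vertices.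

module FlagInequality where

  open import Data.Fin.Base using (Fin)
  open import Data.Fin.Patterns
  open import Data.Bool.Base using (true)
  open import Data.Integer.Base as ℤ using (ℤ; +_; 0ℤ; 1ℤ; -1ℤ; _+_; _*_; _-_; _≤_)
  import Data.Integer.Properties as ℤ
  open import Data.Integer.Tactic.RingSolver using (solve-∀)
  open import Data.List.Base using ([]; _∷_; length)
  open import Relation.Binary.PropositionalEquality
  open SignPolynomials
  open Certificate
  open Sums

  sum⁶ : ∀ {n} → Fn (Fin n) ℤ → ℤ
  sum⁶ f = sum² λ a b → sum⁴ (f a b)

  sum⁶-swap : ∀ {n} i (f : Fn (Fin n) ℤ) → sum⁶ (swapArgs i f) ≡ sum⁶ f
  sum⁶-swap 0F f = sum-comm λ a b → sum⁴ (f b a)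
  sum⁶-swap 1F f = sum-cong λ a → sum-comm λ b c → sum λ d → sum² (f a c b d)
  sum⁶-swap 2F f = sum²-cong λ a b → sum-comm λ c d → sum² (f a b d c)
  sum⁶-swap 3F f = sum²-cong λ a b → sum-cong λ c → sum-comm λ d e → sum (f a b c e d)
  sum⁶-swap 4F f = sum²-cong λ a b → sum²-cong λ c d → sum-comm λ e g → f a b c d g e

  sum⁶-permute : ∀ {n} w (f : Fn (Fin n) ℤ) → sum⁶ (permuteArgs w f) ≡ sum⁶ f
  sum⁶-permute []      f = refl
  sum⁶-permute (i ∷ w) f = trans (sum⁶-swap i (permuteArgs w f)) (sum⁶-permute w f)

  sum⁶-plus : ∀ {n} (f g : Fn (Fin n) ℤ) →
              sum⁶ (λ a b c d e h → f a b c d e h + g a b c d e h) ≡ sum⁶ f + sum⁶ g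
  sum⁶-plus f g = trans
    (sum²-cong λ a b → trans (sum²-cong λ c d → sum²-plus (f a b c d) (g a b c d))
      (sum²-plus (λ c d → sum² (f a b c d)) (λ c d → sum² (g a b c d))))
    (sum²-plus (λ a b → sum⁴ (f a b)) (λ a b → sum⁴ (g a b)))

  sum⁶-nonNegative : ∀ {n} {f : Fn (Fin n) ℤ} → (∀ a b c d e g → 0ℤ ≤ f a b c d e g) → 0ℤ ≤ sum⁶ f
  sum⁶-nonNegative 0≤f =
    sum-nonNegative λ a → sum-nonNegative λ b → sum-nonNegative λ c →
    sum-nonNegative λ d → sum-nonNegative λ e → sum-nonNegative λ g → 0≤f a b c d e g

  tuple : ∀ {A : Set} → Fn A (Fin 6 → A)
  tuple a b c d e f 0F = a
  tuple a b c d e f 1F = b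
  tuple a b c d e f 2F = c
  tuple a b c d e f 3F = d
  tuple a b c d e f 4F = e
  tuple a b c d e f 5F = f

  threeOfSixSigns : (a b c d e f : ℤ) → ℤ
  threeOfSixSigns a b c d e f =
    (let t = a + b + c + d + e + f in + 16 - t * t) * (1ℤ - a * b * c * d * e * f)

  module Inequality {n} (s : Fin n → Fin n → ℤ) (s-sign : ∀ x y → IsSign (s x y))
                    (s-sym : ∀ x y → s x y ≡ s y x) (s-diag : ∀ x → s x x ≡ -1ℤ) where

    open Evaluation s s-sign s-sym s-diag

    rename-tuple : ∀ e x i j k l m o →
      ⟦ rename (tuple i j k l m o) e ⟧ x ≡ ⟦ e ⟧ (tuple (x i) (x j) (x k) (x l) (x m) (x o))
    rename-tuple e x i j k l m o = trans (⟦⟧-rename (tuple i j k l m o) e x) (⟦⟧-cong e λ where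
      0F → refl
      1F → refl
      2F → refl
      3F → refl
      4F → refl
      5F → refl)

    -- Quantifying over arbitrary positions, not just 0F to 5F in order, makes the notion stable
    -- under `swapArgs`, as the induction along a word requires.
    _Evaluates_ : Fn (Fin n) ℤ → Fn (Fin 6) Expr → Set
    f̂ Evaluates f = ∀ x i j k l m o → ⟦ f i j k l m o ⟧ x ≡ f̂ (x i) (x j) (x k) (x l) (x m) (x o)

    swap-evaluates : ∀ i {f̂ f} → f̂ Evaluates f → swapArgs i f̂ Evaluates swapArgs i f
    swap-evaluates 0F ev x i j k l m o = ev x j i k l m o
    swap-evaluates 1F ev x i j k l m o = ev x i k j l m o
    swap-evaluates 2F ev x i j k l m o = ev x i j l k m o
    swap-evaluates 3F ev x i j k l m o = ev x i j k m l o
    swap-evaluates 4F ev x i j k l m o = ev x i j k l o m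

    permute-evaluates : ∀ w {f̂ f} → f̂ Evaluates f → permuteArgs w f̂ Evaluates permuteArgs w f
    permute-evaluates []          ev = ev
    permute-evaluates (i ∷ w) {f̂} {f} ev =
      swap-evaluates i {permuteArgs w f̂} {permuteArgs w f} (permute-evaluates w {f̂} {f} ev)

    -- Reordering the summation variables leaves the total unchanged, so each word contributes one
    -- copy of `sum⁶ f̂`. Any list of words will do; which list is chosen matters only for the
    -- positivity check.
    sum⁶-symmetrised : ∀ {f̂ f} → f̂ Evaluates f → ∀ ws →
      sum⁶ (λ a b c d e g → ⟦ symmetrised f ws ⟧ (tuple a b c d e g)) ≡ + length ws * sum⁶ f̂
    sum⁶-symmetrised ev [] =
      sum²-zero λ a b → sum²-zero λ c d → sum²-zero λ e g → ⟦K⟧ 0ℤ (tuple a b c d e g)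
    sum⁶-symmetrised {f̂} {f} ev (w ∷ ws) = begin
      sum⁶ (λ a b c d e g → ⟦ symmetrised f (w ∷ ws) ⟧ (tuple a b c d e g))
        ≡⟨ (sum²-cong λ a b → sum²-cong λ c d → sum²-cong λ e g → ⟦⊕⟧ _ _ _) ⟩
      sum⁶ (λ a b c d e g → first a b c d e g + rest a b c d e g)
        ≡⟨ sum⁶-plus first rest ⟩
      sum⁶ first + sum⁶ rest
        ≡⟨ cong₂ _+_ first≡ (sum⁶-symmetrised ev ws) ⟩
      sum⁶ f̂ + + length ws * sum⁶ f̂
        ≡⟨ ℤ.suc-* (+ length ws) (sum⁶ f̂) ⟨
      + length (w ∷ ws) * sum⁶ f̂ ∎
      where
      open ≡-Reasoning
      first rest : Fn (Fin n) ℤ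
      first a b c d e g = ⟦ permuteArgs w f 0F 1F 2F 3F 4F 5F ⟧ (tuple a b c d e g)
      rest  a b c d e g = ⟦ symmetrised f ws ⟧ (tuple a b c d e g)
      first≡ : sum⁶ first ≡ sum⁶ f̂
      first≡ = trans
        (sum²-cong λ a b → sum²-cong λ c d → sum²-cong λ e g →
          permute-evaluates w {f̂} {f} ev (tuple a b c d e g) 0F 1F 2F 3F 4F 5F)
        (sum⁶-permute w f̂)

    sum⁶-nonNegative-from : ∀ {f̂ f} → f̂ Evaluates f → ∀ ws .{{_ : ℤ.Positive (+ length ws)}} →
      nonNegativeOnCube (norm (symmetrised f ws)) ≡ true → 0ℤ ≤ sum⁶ f̂
    sum⁶-nonNegative-from {f̂} {f} ev ws eq = ℤ.*-cancelˡ-≤-pos 0ℤ (sum⁶ f̂) (+ length ws)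
      (subst₂ _≤_ (sym (ℤ.*-zeroʳ (+ length ws))) (sum⁶-symmetrised ev ws)
        (sum⁶-nonNegative λ a b c d e g → expr-nonNegative (tuple a b c d e g) (symmetrised f ws) eq))

    eval : Fn (Fin 6) Expr → Fn (Fin n) ℤ
    eval f a b c d e g = ⟦ f 0F 1F 2F 3F 4F 5F ⟧ (tuple a b c d e g)

    slack-nonNegative : 0ℤ ≤ sum⁶ (eval slack)
    slack-nonNegative = sum⁶-nonNegative-from {eval slack} {slack} evaluates splits certificate
      where
      evaluates : eval slack Evaluates slack
      evaluates x = rename-tuple (slack 0F 1F 2F 3F 4F 5F) x

    -- A flag reads positions 0 to 3 only; the repeated z, w merely fill positions 4 and 5.
    flagAt : Flag → Fin n → Fin n → Fin n → Fin n → ℤ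
    flagAt f u v z w = ⟦ onEdges f 0F 1F 2F 3F ⟧ (tuple u v z w z w)

    flagSum : Flag → Fin n → Fin n → ℤ
    flagSum f u v = sum² (flagAt f u v)

    three : Fin n → Fin n → Fin n → Fin n → ℤ
    three z w z′ w′ = ⟦ threeAmong 2F 3F 4F 5F ⟧ (tuple z w z w z′ w′)

    -- The part of the total slack that does not depend on u and v.
    mainTerm : ℤ
    mainTerm = + 33856 * (+ n * (+ n * (+ n * (+ n * 1ℤ))) - sum² s * sum² s) - + 2116 * sum⁴ three

    module _ (u v : Fin n) where

      total : Expr → ℤ
      total e = sum⁴ λ z w z′ w′ → ⟦ e ⟧ (tuple u v z w z′ w′)

      total-⊖ : ∀ e f → total (e ⊖ f) ≡ total e - total f
      total-⊖ e f = trans (sum²-cong λ z w → sum²-cong λ z′ w′ → ⟦⊖⟧ e f _) (sum⁴-minus _ _)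

      total-scale : ∀ k e → total (K k ⊗ e) ≡ k * total e
      total-scale k e = trans
        (sum²-cong λ z w → sum²-cong λ z′ w′ → trans (⟦⊗⟧ (K k) e _) (cong (_* ⟦ e ⟧ _) (⟦K⟧ k _)))
        (sum⁴-*ˡ k _)

      -- The factors share u and v but read disjoint pairs of the remaining four positions, so the
      -- fourfold sum splits. With e = f this produces the squares.
      total-product : ∀ e f → total (rename (tuple 0F 1F 2F 3F 2F 3F) e ⊗ rename
          (tuple 0F 1F 4F 5F 4F 5F) f) ≡
        sum² (λ z w → ⟦ e ⟧ (tuple u v z w z w)) * sum² (λ z w → ⟦ f ⟧ (tuple u v z w z w))
      total-product e f = trans
        (sum²-cong λ z w → sum²-cong λ z′ w′ → trans (⟦⊗⟧ _ _ _) (cong₂ _*_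
          (rename-tuple e (tuple u v z w z′ w′) 0F 1F 2F 3F 2F 3F)
          (rename-tuple f (tuple u v z w z′ w′) 0F 1F 4F 5F 4F 5F)))
        (sum²-* (λ z w → ⟦ e ⟧ (tuple u v z w z w)) (λ z w → ⟦ f ⟧ (tuple u v z w z w)))

      total-one : total (K 1ℤ) ≡ + n * (+ n * (+ n * (+ n * 1ℤ)))
      total-one = trans (sum²-cong λ _ _ → trans (sum²-cong λ _ _ → ⟦K⟧ 1ℤ _) (sum²-const n n 1ℤ))
          (sum²-const n n _)

      total-threeAmong : total (threeAmong 2F 3F 4F 5F) ≡ sum⁴ three
      total-threeAmong = sum²-cong λ z w → sum²-cong λ z′ w′ →
        rename-tuple (threeAmong 2F 3F 4F 5F) (tuple u v z w z′ w′) 2F 3F 2F 3F 4F 5F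

      total-slack : total (slack 0F 1F 2F 3F 4F 5F) ≡
        mainTerm
        - + 8 * (flagSum flag₁ u v * flagSum flag₁ u v)
        - + 2 * (flagSum flag₂ u v * flagSum flag₂ u v)
        - flagSum flag₃ u v * flagSum flag₃ u v
        - + 16 * (flagSum cycleFlag u v * flagSum cycleFlag u v)
      total-slack =
        minus (minus (minus (minus (minus
          (scale (+ 33856) (minus total-one
            (trans (total-product (edge 2F 3F) (edge 2F 3F)) (cong₂ _*_ edges edges))))
          (scale (+ 2116) total-threeAmong))
          (scale (+ 8) (total-product (onEdges flag₁ 0F 1F 2F 3F) (onEdges flag₁ 0F 1F 2F 3F))))
          (scale (+ 2) (total-product (onEdges flag₂ 0F 1F 2F 3F) (onEdges flag₂ 0F 1F 2F 3F))))
          (total-product (onEdges flag₃ 0F 1F 2F 3F) (onEdges flag₃ 0F 1F 2F 3F)))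
          (scale (+ 16) (total-product (onEdges cycleFlag 0F 1F 2F 3F) (onEdges cycleFlag 0F 1F 2F 3F)))
        where
        minus : ∀ {e f x y} → total e ≡ x → total f ≡ y → total (e ⊖ f) ≡ x - y
        minus {e} {f} p q = trans (total-⊖ e f) (cong₂ _-_ p q)
        scale : ∀ k {e x} → total e ≡ x → total (K k ⊗ e) ≡ k * x
        scale k {e} p = trans (total-scale k e) (cong (k *_) p)
        edges : sum² (λ z w → ⟦ edge 2F 3F ⟧ (tuple u v z w z w)) ≡ sum² s
        edges = sum²-cong λ z w → ⟦edge⟧ 2F 3F _

    -- For each (u,v) the total slack is `mainTerm` minus four weighted squares. The first three are
    -- dropped as non-negative; the cycle square, which measures the distance from rank one, is
    -- kept. Summing over (u,v) then uses that the slack has a non-negative sum.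
    inequality :
      + 16 * sum² (λ u v → flagSum cycleFlag u v * flagSum cycleFlag u v) ≤
      + n * (+ n * mainTerm)
    inequality = sum-squares mainTerm (λ u v → total u v (slack 0F 1F 2F 3F 4F 5F)) (flagSum cycleFlag)
      (λ u v → drop-squares (total u v (slack 0F 1F 2F 3F 4F 5F)) mainTerm
        (flagSum flag₁ u v) (flagSum flag₂ u v) (flagSum flag₃ u v) (flagSum cycleFlag u v)
            (total-slack u v))
      slack-nonNegative
      where
      drop-squares : ∀ t m a b c d →
        t ≡ m - + 8 * (a * a) - + 2 * (b * b) - c * c - + 16 * (d * d) → + 16 * (d * d) ≤ m - t
      drop-squares t m a b c d refl = subst₂ _≤_ (ℤ.+-identityˡ _) (lemma m (a * a) (b * b) (c * c)
          (d * d))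
        (ℤ.+-monoˡ-≤ (+ 16 * (d * d)) (ℤ.+-mono-≤ (ℤ.+-mono-≤
          (ℤ.*-monoˡ-≤-nonNeg (+ 8) (square-nonNegative a))
          (ℤ.*-monoˡ-≤-nonNeg (+ 2) (square-nonNegative b)))
          (square-nonNegative c)))
        where
        lemma : ∀ m a b c d → + 8 * a + + 2 * b + c + + 16 * d ≡
                              m - (m - + 8 * a - + 2 * b - c - + 16 * d)
        lemma = solve-∀
      sum-squares : ∀ m (t d : Fin n → Fin n → ℤ) → (∀ u v → + 16 * (d u v * d u v) ≤ m - t u v) →
                    0ℤ ≤ sum² t → + 16 * sum² (λ u v → d u v * d u v) ≤ + n * (+ n * m)
      sum-squares m t d le 0≤t = begin
        + 16 * sum² (λ u v → d u v * d u v)    ≡⟨ sum²-*ˡ (+ 16) _ ⟨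
        sum² (λ u v → + 16 * (d u v * d u v))  ≤⟨ sum²-mono le ⟩
        sum² (λ u v → m - t u v)               ≡⟨ sum²-minus (λ _ _ → m) t ⟩
        sum² {n} {n} (λ _ _ → m) - sum² t      ≤⟨ ℤ.+-monoʳ-≤ (sum² {n} {n} (λ _ _ → m))
            (ℤ.neg-mono-≤ 0≤t) ⟩
        sum² {n} {n} (λ _ _ → m) - 0ℤ          ≡⟨ ℤ.+-identityʳ _ ⟩
        sum² {n} {n} (λ _ _ → m)               ≡⟨ sum²-const n n m ⟩
        + n * (+ n * m)                        ∎
        where open ℤ.≤-Reasoning

    opaque
      unfolding ⟦_⟧

      flagSum-cycleFlag : ∀ u v → flagSum cycleFlag u v ≡ sum²
          (λ z w → 1ℤ - s u z * s v z * s u w * s v w)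
      flagSum-cycleFlag u v = refl

      three≡ : ∀ z w z′ w′ → three z w z′ w′ ≡ threeOfSixSigns (s z w) (s z z′) (s z w′) (s w z′)
          (s w w′) (s z′ w′)
      three≡ z w z′ w′ = refl

    cycleSum : Fin n → Fin n → ℤ
    cycleSum u v = sum² λ z w → 1ℤ - s u z * s v z * s u w * s v w

    threeSum : ℤ
    threeSum = sum⁴ λ z w z′ w′ → threeOfSixSigns (s z w) (s z z′) (s z w′) (s w z′) (s w w′) (s z′ w′)

    -- The literal 2116 becomes a variable β: the later estimates rest only on the ratio 16 of the
    -- two coefficients and on 1 ≤ β.
    cycle-inequality : ∀ {β} → β ≡ + 2116 →
      + 16 * sum² (λ u v → cycleSum u v * cycleSum u v) ≤
      + n * (+ n * (+ 16 * β * (+ n * (+ n * (+ n * (+ n * 1ℤ))) - sum² s * sum² s) - β * threeSum))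
    cycle-inequality {β} β≡ = restate {sum² (λ u v → flagSum cycleFlag u v * flagSum cycleFlag u v)}
      {sum² (λ u v → cycleSum u v * cycleSum u v)} {sum⁴ three} {threeSum} {+ 33856} {+ 2116} {β} {+ n}
      {+ n * (+ n * (+ n * (+ n * 1ℤ))) - sum² s * sum² s} {mainTerm}
      (sum²-cong λ u v → cong₂ _*_ (flagSum-cycleFlag u v) (flagSum-cycleFlag u v))
      (sum²-cong λ a b → sum²-cong λ c d → three≡ a b c d) (sixteen β≡) (sym β≡) refl inequality
      where
      sixteen : ∀ {β} → β ≡ + 2116 → + 33856 ≡ + 16 * β
      sixteen refl = refl
      restate : ∀ {S S′ T T′ α γ β N r m} → S ≡ S′ → T ≡ T′ → α ≡ + 16 * β → γ ≡ β → m ≡ α * r - γ * T →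
                + 16 * S ≤ N * (N * m) → + 16 * S′ ≤ N * (N * (+ 16 * β * r - β * T′))
      restate refl refl refl refl refl le = le

-- From a small cycle defect to a symmetric rank one sign matrix.

module Stability where

  open import Data.Fin.Base using (Fin; suc)
  open import Data.Integer.Base as ℤ using (ℤ; +_; 0ℤ; 1ℤ; -1ℤ; _+_; _*_; _-_; _≤_; _<_)
  import Data.Integer.Properties as ℤ
  open import Data.Integer.Tactic.RingSolver using (solve-∀)
  open import Data.Nat.Base as ℕ using (ℕ; suc)
  open import Data.Product.Base using (_×_; _,_; ∃; proj₁; proj₂)
  open import Data.Sum.Base using (inj₁; inj₂)
  open import Relation.Binary.PropositionalEquality
  open import Relation.Nullary.Negation using (contradiction)
  open import Relation.Nullary.Decidable using (yes; no)
  open SignPolynomials using (IsSign; sign²≡1)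
  open Sums

  sign-* : ∀ {x y} → IsSign x → IsSign y → IsSign (x * y)
  sign-* (inj₁ refl) (inj₁ refl) = inj₁ refl
  sign-* (inj₁ refl) (inj₂ refl) = inj₂ refl
  sign-* (inj₂ refl) (inj₁ refl) = inj₂ refl
  sign-* (inj₂ refl) (inj₂ refl) = inj₁ refl

  -- 1 - x y is twice the indicator of x ≠ y.
  sign-triangle : ∀ {x y z} → IsSign x → IsSign y → IsSign z → 1ℤ - x * y ≤ (1ℤ - x * z) + (1ℤ - z * y)
  sign-triangle (inj₁ refl) (inj₁ refl) (inj₁ refl) = ℤ.+≤+ ℕ.z≤n
  sign-triangle (inj₁ refl) (inj₁ refl) (inj₂ refl) = ℤ.+≤+ ℕ.z≤n
  sign-triangle (inj₁ refl) (inj₂ refl) (inj₁ refl) = ℤ.≤-refl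
  sign-triangle (inj₁ refl) (inj₂ refl) (inj₂ refl) = ℤ.≤-refl
  sign-triangle (inj₂ refl) (inj₁ refl) (inj₁ refl) = ℤ.≤-refl
  sign-triangle (inj₂ refl) (inj₁ refl) (inj₂ refl) = ℤ.≤-refl
  sign-triangle (inj₂ refl) (inj₂ refl) (inj₁ refl) = ℤ.+≤+ ℕ.z≤n
  sign-triangle (inj₂ refl) (inj₂ refl) (inj₂ refl) = ℤ.+≤+ ℕ.z≤n

  sign-≤ : ∀ {x y} → IsSign x → IsSign y → x - y ≤ 1ℤ - x * y
  sign-≤ (inj₁ refl) (inj₁ refl) = ℤ.≤-refl
  sign-≤ (inj₁ refl) (inj₂ refl) = ℤ.≤-refl
  sign-≤ (inj₂ refl) (inj₁ refl) = ℤ.-≤+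
  sign-≤ (inj₂ refl) (inj₂ refl) = ℤ.≤-refl

  sign-≤1 : ∀ {x} → IsSign x → x ≤ 1ℤ
  sign-≤1 (inj₁ refl) = ℤ.≤-refl
  sign-≤1 (inj₂ refl) = ℤ.-≤+

  *-nonNegative : ∀ {x y} → 0ℤ ≤ x → 0ℤ ≤ y → 0ℤ ≤ x * y
  *-nonNegative {x} {y} 0≤x 0≤y =
    subst (_≤ x * y) (ℤ.*-zeroʳ x) (ℤ.*-monoˡ-≤-nonNeg x {{ℤ.nonNegative 0≤x}} 0≤y)

  x²≤y²⇒x≤y : ∀ {x y} → 0ℤ ≤ y → x * x ≤ y * y → x ≤ y
  x²≤y²⇒x≤y {x} {y} 0≤y x²≤y² with x ℤ.≤? y
  ... | yes x≤y = x≤y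
  ... | no  x≰y = contradiction (ℤ.≤-<-trans y²≤xy (ℤ.<-≤-trans xy<x² x²≤y²)) (ℤ.<-irrefl refl)
    where
    y<x = ℤ.≰⇒> x≰y
    y²≤xy : y * y ≤ x * y
    y²≤xy = ℤ.*-monoʳ-≤-nonNeg y {{ℤ.nonNegative 0≤y}} (ℤ.<⇒≤ y<x)
    xy<x² : x * y < x * x
    xy<x² = ℤ.*-monoˡ-<-pos x {{ℤ.positive (ℤ.≤-<-trans 0≤y y<x)}} y<x

  amgm : ∀ x y → + 2 * (x * y) ≤ x * x + y * y
  amgm x y = ℤ.0≤i-j⇒j≤i (subst (0ℤ ≤_) (lemma x y) (square-nonNegative (x - y)))
    where
    lemma : ∀ x y → (x - y) * (x - y) ≡ x * x + y * y - + 2 * (x * y)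
    lemma = solve-∀

  -- Twice the number of ordered pairs on which s differs from the rank one sign matrix σ p pᵀ.
  mismatch : ∀ {n} → (Fin n → Fin n → ℤ) → ℤ → (Fin n → ℤ) → ℤ
  mismatch s σ p = sum² λ v w → 1ℤ - s v w * (σ * (p v * p w))

  positive-2n² : ∀ n .{{_ : ℕ.NonZero n}} → ℤ.Positive (+ 2 * (+ n * + n))
  positive-2n² (suc n) = _

  module Structure (n : ℕ) .{{n≢0 : ℕ.NonZero n}} (s : Fin n → Fin n → ℤ) (s-sign : ∀ x y → IsSign
      (s x y))
                   (s-sym : ∀ x y → s x y ≡ s y x) where

    N : ℤ
    N = + n

    C : Fin n → Fin n → ℤ
    C u v = sum² (λ z w → 1ℤ - s u z * s v z * s u w * s v w)

    -- AM-GM, applied to H · C(u,v) and n² for each pair, takes the place of Cauchy-Schwarz and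
    -- passes from the second moment to the first without a root.
    sum²-C : ∀ (H : ℤ) → H * H * sum² (λ u v → C u v * C u v) ≤ N * (N * (N * N * (N * N))) →
             H * sum² C ≤ N * (N * (N * N))
    sum²-C H le = ℤ.*-cancelˡ-≤-pos (H * sum² C) (N * (N * (N * N)))
        (+ 2 * (N * N)) {{positive-2n² n}} (begin
      + 2 * (N * N) * (H * sum² C)
        ≡⟨ trans (lemma₁ N H (sum² C)) (sym (sum²-*ˡ (+ 2 * (N * N) * H) C)) ⟩
      sum² (λ u v → + 2 * (N * N) * H * C u v)
        ≤⟨ sum²-mono (λ u v → subst₂ _≤_ (lemma₂ N H (C u v)) (lemma₃ N H (C u v))
            (amgm (H * C u v) (N * N))) ⟩
      sum² (λ u v → H * H * (C u v * C u v) + N * N * (N * N))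
        ≡⟨ trans (sum²-plus (λ u v → H * H * (C u v * C u v)) (λ _ _ → N * N * (N * N)))
             (cong₂ _+_ (sum²-*ˡ (H * H) (λ u v → C u v * C u v)) (sum²-const n n (N * N * (N * N)))) ⟩
      H * H * sum² (λ u v → C u v * C u v) + N * (N * (N * N * (N * N)))
        ≤⟨ ℤ.+-monoˡ-≤ (N * (N * (N * N * (N * N)))) le ⟩
      N * (N * (N * N * (N * N))) + N * (N * (N * N * (N * N)))
        ≡⟨ lemma₄ N ⟩
      + 2 * (N * N) * (N * (N * (N * N))) ∎)
      where
      open ℤ.≤-Reasoning
      lemma₁ : ∀ N H c → + 2 * (N * N) * (H * c) ≡ + 2 * (N * N) * H * c
      lemma₁ = solve-∀
      lemma₂ : ∀ N H c → + 2 * (H * c * (N * N)) ≡ + 2 * (N * N) * H * c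
      lemma₂ = solve-∀
      lemma₃ : ∀ N H c → H * c * (H * c) + N * N * (N * N) ≡ H * H * (c * c) + N * N * (N * N)
      lemma₃ = solve-∀
      lemma₄ : ∀ N → N * (N * (N * N * (N * N))) + N * (N * (N * N * (N * N))) ≡ + 2 * (N * N) *
          (N * (N * (N * N)))
      lemma₄ = solve-∀

    -- Averaging twice, over u and then over z, gives a pair whose defect is at most the mean. For
    -- such a pair s(v,w) mostly equals s(v,z) times s(u,z) s(u,w), a function of v times a function
    -- of w.
    anchor : ∀ H → H * sum² C ≤ N * (N * (N * N)) →
      ∃ λ u → ∃ λ z → H * sum² (λ v w → 1ℤ - s u z * s v z * s u w * s v w) ≤ N * N
    anchor H le =
      let u , le₁ = exists-≤-average n (λ u → H * sum² (λ z v → sum (λ w → D u z v w))) (N * (N * N))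
                      (subst (_≤ _) (trans (cong (H *_) reorder) (sym (sum-*ˡ H _))) le)
          z , le₂ = exists-≤-average n (λ z → H * sum² (D u z)) (N * N)
                      (subst (_≤ _) (sym (sum-*ˡ H _)) le₁)
      in u , z , le₂
      where
      D : Fin n → Fin n → Fin n → Fin n → ℤ
      D u z v w = 1ℤ - s u z * s v z * s u w * s v w
      reorder : sum² C ≡ sum (λ u → sum² (λ z v → sum (λ w → D u z v w)))
      reorder = sum-cong λ u → sum-comm (λ v z → sum (λ w → D u z v w))

    module _ (p q : Fin n → ℤ) (p-sign : ∀ v → IsSign (p v)) (q-sign : ∀ v → IsSign (q v)) where

      -- `W` is twice the number of ordered pairs where s differs from p qᵀ. `T` is the correlation
      -- of p and q: it is close to n or -n when q agrees with p or with -p at most vertices.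
      W T : ℤ
      W = sum² λ v w → 1ℤ - s v w * (p v * q w)
      T = sum λ v → p v * q v

      r-sign : ∀ v → IsSign (p v * q v)
      r-sign v = sign-* (p-sign v) (q-sign v)

      -- Both p v q w and q v p w agree with s v w for most pairs, by symmetry of s.
      N²-T²≤2W : N * N - T * T ≤ + 2 * W
      N²-T²≤2W = begin
        N * N - T * T
          ≡⟨ cong₂ _-_ (trans (cong (λ z → N * z) (sym (ℤ.*-identityʳ N))) (sym (sum²-const n n 1ℤ)))
                       (trans (sym (trans (sum-cong λ v → sum-*ˡ (p v * q v) (λ w → p w * q w))
                           (trans (sum-cong λ v → ℤ.*-comm (p v * q v) T)
                               (sum-*ˡ T (λ v → p v * q v))))) (sum²-cong λ v w → lemma (p v) (q v)
                                   (p w) (q w))) ⟩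
        sum² {n} {n} (λ _ _ → 1ℤ) - sum² (λ v w → p v * q w * (q v * p w))
          ≡⟨ sum²-minus (λ _ _ → 1ℤ) (λ v w → p v * q w * (q v * p w)) ⟨
        sum² (λ v w → 1ℤ - p v * q w * (q v * p w))
          ≤⟨ sum²-mono (λ v w → sign-triangle (sign-* (p-sign v) (q-sign w))
              (sign-* (q-sign v) (p-sign w)) (s-sign v w)) ⟩
        sum² (λ v w → (1ℤ - p v * q w * s v w) + (1ℤ - s v w * (q v * p w)))
          ≡⟨ sum²-plus _ _ ⟩
        sum² (λ v w → 1ℤ - p v * q w * s v w) + sum² (λ v w → 1ℤ - s v w * (q v * p w))
          ≡⟨ cong₂ _+_ (sum²-cong λ v w → cong (1ℤ -_) (ℤ.*-comm (p v * q w) (s v w)))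
               (trans (sum-comm _) (sum²-cong λ v w → cong (1ℤ -_) (cong₂ _*_ (s-sym w v)
                   (ℤ.*-comm (q w) (p v))))) ⟩
        W + W
          ≡⟨ double W ⟩
        + 2 * W ∎
        where
        open ℤ.≤-Reasoning
        lemma : ∀ a b c d → a * b * (c * d) ≡ a * d * (b * c)
        lemma = solve-∀
        double : ∀ w → w + w ≡ + 2 * w
        double = solve-∀

      T-bound : ∀ {σ} → IsSign σ → σ * T ≤ N
      T-bound {σ} sσ = begin
        σ * T                          ≡⟨ sum-*ˡ σ _ ⟨
        sum (λ v → σ * (p v * q v))    ≤⟨ sum-mono (λ v → sign-≤1 (sign-* sσ (r-sign v))) ⟩
        sum {n} (λ _ → 1ℤ)             ≡⟨ sum-const n 1ℤ ⟩
        N * 1ℤ                         ≡⟨ ℤ.*-identityʳ N ⟩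
        N                              ∎
        where open ℤ.≤-Reasoning

      majority : ∃ λ σ → IsSign σ × 0ℤ ≤ σ * T
      majority with 0ℤ ℤ.≤? T
      ... | yes 0≤T = 1ℤ , inj₁ refl , subst (0ℤ ≤_) (sym (ℤ.*-identityˡ T)) 0≤T
      ... | no  0≰T = -1ℤ , inj₂ refl , subst (0ℤ ≤_) (sym (ℤ.-1*i≡-i T))
          (ℤ.neg-mono-≤ (ℤ.<⇒≤ (ℤ.≰⇒> 0≰T)))

      module _ {σ} (sσ : IsSign σ) (0≤σT : 0ℤ ≤ σ * T) where

        -- N² - T² = (N - σT)(N + σT), and the second factor is at least N because σ is chosen with
        -- σT ≥ 0. The first factor is twice the number of vertices where q differs from σp.
        N*[N-σT]≤2W : N * (N - σ * T) ≤ + 2 * W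
        N*[N-σT]≤2W = begin
          N * (N - σ * T)
            ≡⟨ ℤ.*-comm N (N - σ * T) ⟩
          (N - σ * T) * N
            ≤⟨ ℤ.*-monoˡ-≤-nonNeg (N - σ * T) {{ℤ.nonNegative (ℤ.i≤j⇒0≤j-i (T-bound sσ))}}
                 (subst (_≤ N + σ * T) (ℤ.+-identityʳ N) (ℤ.+-monoʳ-≤ N 0≤σT)) ⟩
          (N - σ * T) * (N + σ * T)
            ≡⟨ trans (lemma N σ T) (cong (λ z → N * N - z * (T * T)) (sign²≡1 sσ)) ⟩
          N * N - 1ℤ * (T * T)
            ≡⟨ cong (N * N -_) (ℤ.*-identityˡ (T * T)) ⟩
          N * N - T * T
            ≤⟨ N²-T²≤2W ⟩
          + 2 * W ∎
          where
          open ℤ.≤-Reasoning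
          lemma : ∀ N σ T → (N - σ * T) * (N + σ * T) ≡ N * N - σ * σ * (T * T)
          lemma = solve-∀

        -- The triangle inequality through p qᵀ: s differs from it at cost `W`, and replacing q by
        -- σp costs N(N - σT) ≤ 2W more.
        mismatch-bound : mismatch s σ p ≤ + 3 * W
        mismatch-bound = begin
          mismatch s σ p
            ≤⟨ sum²-mono (λ v w → sign-triangle (s-sign v w)
                (sign-* sσ (sign-* (p-sign v) (p-sign w))) (sign-* (p-sign v) (q-sign w))) ⟩
          sum² (λ v w → (1ℤ - s v w * (p v * q w)) + (1ℤ - p v * q w * (σ * (p v * p w))))
            ≡⟨ sum²-plus _ _ ⟩
          W + sum² (λ v w → 1ℤ - p v * q w * (σ * (p v * p w)))
            ≡⟨ cong (λ z → W + z) (sum²-cong λ v w → cong (1ℤ -_)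
                (trans (lemma₁ (p v) (q w) σ (p w))
                    (trans (cong (_* (σ * (p w * q w))) (sign²≡1 (p-sign v))) (ℤ.*-identityˡ _)))) ⟩
          W + sum² {n} (λ v w → 1ℤ - σ * (p w * q w))
            ≡⟨ cong (λ z → W + z) (trans (sum-const n _) (cong (N *_)
                 (trans (sum-minus (λ _ → 1ℤ) (λ w → σ * (p w * q w)))
                     (cong₂ _-_ (trans (sum-const n 1ℤ) (ℤ.*-identityʳ N)) (sum-*ˡ σ _))))) ⟩
          W + N * (N - σ * T)
            ≤⟨ ℤ.+-monoʳ-≤ W N*[N-σT]≤2W ⟩
          W + + 2 * W
            ≡⟨ lemma₂ W ⟩
          + 3 * W ∎
          where
          open ℤ.≤-Reasoning
          lemma₁ : ∀ a b σ c → a * b * (σ * (a * c)) ≡ a * a * (σ * (c * b))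
          lemma₁ = solve-∀
          lemma₂ : ∀ w → w + + 2 * w ≡ + 3 * w
          lemma₂ = solve-∀

      module _ {σ} (sσ : IsSign σ) where

        -- (Σp)² is the sum of all p(v) p(w), which differs from the sum of σ s(v,w) by at most the
        -- mismatch. So a density close to ½ forces the parts to have nearly equal sizes.
        [Σp]²-bound : sum p * sum p ≤ σ * sum² s + mismatch s σ p
        [Σp]²-bound = subst (_≤ σ * sum² s + mismatch s σ p) (lemma₁ (sum p * sum p) (σ * sum² s))
          (ℤ.+-monoʳ-≤ (σ * sum² s) (begin
            sum p * sum p - σ * sum² s
              ≡⟨ cong₂ _-_
                   (sym (trans (sum-cong λ v → trans (sum-*ˡ (p v) p) (ℤ.*-comm (p v) (sum p)))
                       (sum-*ˡ (sum p) p)))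
                   (sym (sum²-*ˡ σ s)) ⟩
            sum² (λ v w → p v * p w) - sum² (λ v w → σ * s v w)
              ≡⟨ sum²-minus _ _ ⟨
            sum² (λ v w → p v * p w - σ * s v w)
              ≤⟨ sum²-mono (λ v w → sign-≤ (sign-* (p-sign v) (p-sign w)) (sign-* sσ (s-sign v w))) ⟩
            sum² (λ v w → 1ℤ - p v * p w * (σ * s v w))
              ≡⟨ (sum²-cong λ v w → cong (λ z → 1ℤ - z) (lemma₂ (p v) (p w) σ (s v w))) ⟩
            mismatch s σ p ∎))
          where
          open ℤ.≤-Reasoning
          lemma₁ : ∀ x y → y + (x - y) ≡ x
          lemma₁ = solve-∀
          lemma₂ : ∀ a b σ s → a * b * (σ * s) ≡ s * (σ * (a * b))
          lemma₂ = solve-∀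

    module _ (κ H : ℤ) (H≡4κ² : H ≡ + 4 * (κ * κ)) (R≤ : H * H * (sum² s * sum² s) ≤ N * N * (N * N))
             (u z : Fin n) (HW≤ : H * sum² (λ v w → 1ℤ - s u z * s v z * s u w * s v w) ≤ N * N) where

      0≤H : 0ℤ ≤ H
      0≤H = subst (0ℤ ≤_) (sym H≡4κ²) (*-nonNegative {+ 4} (ℤ.+≤+ ℕ.z≤n) (square-nonNegative κ))
      p : Fin n → ℤ
      p v = s v z
      q : Fin n → ℤ
      q w = s u z * s u w
      p-sign : ∀ v → IsSign (p v)
      p-sign v = s-sign v z
      q-sign : ∀ w → IsSign (q w)
      q-sign w = sign-* (s-sign u z) (s-sign u w)
      HW≤′ : H * W p q p-sign q-sign ≤ N * N
      HW≤′ = subst (λ t → H * t ≤ N * N)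
        (sum²-cong λ v w → cong (λ t → 1ℤ - t) (lemma (s u z) (s v z) (s u w) (s v w))) HW≤
        where
        lemma : ∀ a b c d → a * b * c * d ≡ d * (b * (a * c))
        lemma = solve-∀
      major = majority p q p-sign q-sign
      σ = proj₁ major
      sσ = proj₁ (proj₂ major)
      H*mismatch≤ : H * mismatch s σ p ≤ + 3 * (N * N)
      H*mismatch≤ = begin
        H * mismatch s σ p
          ≤⟨ ℤ.*-monoˡ-≤-nonNeg H {{ℤ.nonNegative 0≤H}}
               (mismatch-bound p q p-sign q-sign sσ (proj₂ (proj₂ major))) ⟩
        H * (+ 3 * W p q p-sign q-sign)
          ≡⟨ lemma H (W p q p-sign q-sign) ⟩
        + 3 * (H * W p q p-sign q-sign)
          ≤⟨ ℤ.*-monoˡ-≤-nonNeg (+ 3) HW≤′ ⟩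
        + 3 * (N * N) ∎
        where
        open ℤ.≤-Reasoning
        lemma : ∀ H w → H * (+ 3 * w) ≡ + 3 * (H * w)
        lemma = solve-∀
      HσR≤ : H * (σ * sum² s) ≤ N * N
      HσR≤ = x²≤y²⇒x≤y (square-nonNegative N) (subst (_≤ N * N * (N * N)) (sym (begin
        H * (σ * sum² s) * (H * (σ * sum² s))  ≡⟨ lemma H σ (sum² s) ⟩
        σ * σ * (H * H * (sum² s * sum² s))    ≡⟨ cong (_* (H * H * (sum² s * sum² s))) (sign²≡1 sσ) ⟩
        1ℤ * (H * H * (sum² s * sum² s))       ≡⟨ ℤ.*-identityˡ _ ⟩
        H * H * (sum² s * sum² s)              ∎)) R≤)
        where
        open ≡-Reasoning
        lemma : ∀ H σ R → H * (σ * R) * (H * (σ * R)) ≡ σ * σ * (H * H * (R * R))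
        lemma = solve-∀
      -- The factor 4 in H = 4κ² absorbs 1 + 3, the bounds for the density term and for the
      -- mismatch, so that both sides become squares and the root can be taken.
      balanced : ∀ {τ} → IsSign τ → κ * (τ * sum p) ≤ N
      balanced {τ} sτ = x²≤y²⇒x≤y (ℤ.+≤+ ℕ.z≤n) (ℤ.*-cancelˡ-≤-pos _ _ (+ 4) (begin
        + 4 * (κ * (τ * sum p) * (κ * (τ * sum p)))
          ≡⟨ trans (lemma₁ κ τ (sum p)) (cong₂ (λ t h → t * (h * (sum p * sum p))) (sign²≡1 sτ)
              (sym H≡4κ²)) ⟩
        1ℤ * (H * (sum p * sum p))
          ≡⟨ ℤ.*-identityˡ (H * (sum p * sum p)) ⟩
        H * (sum p * sum p)
          ≤⟨ ℤ.*-monoˡ-≤-nonNeg H {{ℤ.nonNegative 0≤H}} ([Σp]²-bound p q p-sign q-sign sσ) ⟩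
        H * (σ * sum² s + mismatch s σ p)
          ≡⟨ ℤ.*-distribˡ-+ H (σ * sum² s) (mismatch s σ p) ⟩
        H * (σ * sum² s) + H * mismatch s σ p
          ≤⟨ ℤ.+-mono-≤ HσR≤ H*mismatch≤ ⟩
        N * N + + 3 * (N * N)
          ≡⟨ lemma₂ (N * N) ⟩
        + 4 * (N * N) ∎))
        where
        open ℤ.≤-Reasoning
        lemma₁ : ∀ k τ b → + 4 * (k * (τ * b) * (k * (τ * b))) ≡ τ * τ * (+ 4 * (k * k) * (b * b))
        lemma₁ = solve-∀
        lemma₂ : ∀ x → x + + 3 * x ≡ + 4 * x
        lemma₂ = solve-∀

    -- The quantifier over the sign τ expresses a bound on the absolute value of Σp. The precision
    -- drops from H² in the hypotheses to H for the mismatch (AM-GM) and to κ for the balance (a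
    -- root).
    structure : ∀ κ H → H ≡ + 4 * (κ * κ) →
      H * H * sum² (λ u v → C u v * C u v) ≤ N * (N * (N * N * (N * N))) →
      H * H * (sum² s * sum² s) ≤ N * N * (N * N) →
      ∃ λ σ → ∃ λ p → IsSign σ × (∀ v → IsSign (p v)) × H * mismatch s σ p ≤ + 3 * (N * N) ×
        (∀ {τ} → IsSign τ → κ * (τ * sum p) ≤ N)
    structure κ H H≡4κ² C≤ R≤ =
      let u , z , HW≤ = anchor H (sum²-C H C≤) in
      σ κ H H≡4κ² R≤ u z HW≤ , p κ H H≡4κ² R≤ u z HW≤ , sσ κ H H≡4κ² R≤ u z HW≤ , p-sign κ H H≡4κ²
          R≤ u z HW≤ ,
      H*mismatch≤ κ H H≡4κ² R≤ u z HW≤ , balanced κ H H≡4κ² R≤ u z HW≤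

-- Counting 4-sets that span three edges by ordered quadruples.

module Counting where

  open import Defs
  open import Data.Bool.Base using (Bool; true; false; not; _∧_; T)
  open import Data.Bool.Properties using (T?) renaming (_≟_ to _≟ᵇ_)
  open import Data.Fin.Base using (Fin; zero; suc)
  import Data.Fin.Properties as Fin
  open import Data.Fin.Subset using (Subset; inside; ∣_∣)
  open import Data.Fin.Subset.Properties using (_∈?_)
  open import Data.Integer.Base as ℤ using (ℤ; +_; 0ℤ; 1ℤ; -1ℤ; _+_; _*_; _-_; _≤_)
  import Data.Integer.Properties as ℤ
  open import Data.Integer.Tactic.RingSolver using (solve-∀)
  open import Data.List.Base using (List; []; _∷_; _++_; length; map; filter; tabulate; allFin;
      cartesianProduct)
  open import Data.Nat.Base as ℕ using (ℕ; zero; suc)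
  import Data.Nat.Properties as ℕ
  open import Data.Product.Base using (_×_; _,_; uncurry)
  open import Data.Sum.Base using (inj₁; inj₂)
  open import Data.Vec.Base as Vec using ([]; _∷_; lookup; _[_]≔_; replicate)
  open import Data.Vec.Properties using (lookup-replicate)
  open import Relation.Binary.PropositionalEquality
  open import Relation.Binary.Definitions using (tri<; tri≈; tri>)
  open import Relation.Nullary.Decidable using (Dec; does; yes; no; dec-true; dec-false; toWitness;
      _×-dec_)
  open import Relation.Unary using (Pred; Decidable)
  open import Level using (Level)
  open SignPolynomials using (IsSign)
  open FlagInequality using (threeOfSixSigns)
  open Sums

  private variable
    ℓ : Level
    A B : Set
    n : ℕ

  ind : Bool → ℤ
  ind false = 0ℤ
  ind true  = 1ℤ

  ind-∧ : ∀ a b → ind (a ∧ b) ≡ ind a * ind b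
  ind-∧ false b = refl
  ind-∧ true  b = sym (ℤ.*-identityˡ (ind b))

  listSum : (A → ℤ) → List A → ℤ
  listSum f []       = 0ℤ
  listSum f (x ∷ xs) = f x + listSum f xs

  listSum-cong : {f g : A → ℤ} → (∀ x → f x ≡ g x) → ∀ xs → listSum f xs ≡ listSum g xs
  listSum-cong f≗g []       = refl
  listSum-cong f≗g (x ∷ xs) = cong₂ _+_ (f≗g x) (listSum-cong f≗g xs)

  listSum-++ : ∀ (f : A → ℤ) xs ys → listSum f (xs ++ ys) ≡ listSum f xs + listSum f ys
  listSum-++ f []       ys = sym (ℤ.+-identityˡ _)
  listSum-++ f (x ∷ xs) ys = trans (cong (λ z → f x + z) (listSum-++ f xs ys))
      (sym (ℤ.+-assoc (f x) _ _))

  listSum-map : ∀ (f : B → ℤ) (g : A → B) xs → listSum f (map g xs) ≡ listSum (λ x → f (g x)) xs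
  listSum-map f g []       = refl
  listSum-map f g (x ∷ xs) = cong (λ z → f (g x) + z) (listSum-map f g xs)

  listSum-*ˡ : ∀ c (f : A → ℤ) xs → listSum (λ x → c * f x) xs ≡ c * listSum f xs
  listSum-*ˡ c f []       = sym (ℤ.*-zeroʳ c)
  listSum-*ˡ c f (x ∷ xs) = trans (cong (λ z → c * f x + z) (listSum-*ˡ c f xs))
      (sym (ℤ.*-distribˡ-+ c _ _))

  listSum-zero : ∀ (xs : List A) → listSum (λ _ → 0ℤ) xs ≡ 0ℤ
  listSum-zero []       = refl
  listSum-zero (x ∷ xs) = trans (ℤ.+-identityˡ _) (listSum-zero xs)

  listSum-sum-comm : ∀ (f : A → Fin n → ℤ) xs →
                     listSum (λ x → sum (f x)) xs ≡ sum (λ i → listSum (λ x → f x i) xs)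
  listSum-sum-comm {n = n} f [] = sym (trans (sum-const n 0ℤ) (ℤ.*-zeroʳ (+ n)))
  listSum-sum-comm f (x ∷ xs) = trans (cong (λ z → sum (f x) + z) (listSum-sum-comm f xs))
      (sym (sum-plus (f x) _))

  listSum-filter : ∀ {P : Pred A ℓ} (P? : Decidable P) (f : A → ℤ) xs →
                   listSum f (filter P? xs) ≡ listSum (λ x → ind (does (P? x)) * f x) xs
  listSum-filter P? f []       = refl
  listSum-filter P? f (x ∷ xs) with does (P? x)
  ... | true  = cong₂ _+_ (sym (ℤ.*-identityˡ (f x))) (listSum-filter P? f xs)
  ... | false = trans (listSum-filter P? f xs) (sym (ℤ.+-identityˡ _))

  length-filter : ∀ {P : Pred A ℓ} (P? : Decidable P) xs →
                  + length (filter P? xs) ≡ listSum (λ x → ind (does (P? x))) xs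
  length-filter P? []       = refl
  length-filter P? (x ∷ xs) with does (P? x)
  ... | true  = cong (λ z → 1ℤ + z) (length-filter P? xs)
  ... | false = trans (length-filter P? xs) (sym (ℤ.+-identityˡ _))

  listSum-cartesianProduct : ∀ (f : A × B → ℤ) xs ys →
    listSum f (cartesianProduct xs ys) ≡ listSum (λ x → listSum (λ y → f (x , y)) ys) xs
  listSum-cartesianProduct f []       ys = refl
  listSum-cartesianProduct f (x ∷ xs) ys = trans (listSum-++ f (map (x ,_) ys) _)
    (cong₂ _+_ (listSum-map f (x ,_) ys) (listSum-cartesianProduct f xs ys))

  listSum-tabulate : ∀ (f : A → ℤ) (g : Fin n → A) → listSum f (tabulate g) ≡ sum (λ i → f (g i))
  listSum-tabulate {n = zero}  f g = sym (sum-zero _)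
  listSum-tabulate {n = suc n} f g = trans (cong (λ z → f (g zero) + z) (listSum-tabulate f
      (λ i → g (suc i))))
                                           (sym (sum-suc _))

  listSum-vertexPairs : ∀ (f : Fin n × Fin n → ℤ) →
    listSum f (vertexPairs n) ≡ sum² (λ i j → ind (does (i Fin.<? j)) * f (i , j))
  listSum-vertexPairs {n} f = trans (listSum-filter (uncurry Fin._<?_) f
      (cartesianProduct (allFin n) (allFin n)))
    (trans (listSum-cartesianProduct _ (allFin n) (allFin n))
      (trans (listSum-cong (λ i → listSum-tabulate _ (λ j → j)) (allFin n)) (listSum-tabulate _
          (λ i → i))))

  -- Each unordered pair is counted once in vertexPairs and twice in the double sum.
  double-length-vertexPairs : ∀ {P : Pred (Fin n × Fin n) ℓ} (P? : Decidable P) →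
    (∀ i j → does (P? (i , j)) ≡ does (P? (j , i))) → (∀ i → does (P? (i , i)) ≡ false) →
    + 2 * + length (filter P? (vertexPairs n)) ≡ sum² (λ i j → ind (does (P? (i , j))))
  double-length-vertexPairs {n} P? P-sym P-irrefl = begin
    + 2 * + length (filter P? (vertexPairs n))
      ≡⟨ cong (+ 2 *_) (trans (length-filter P? (vertexPairs n)) (listSum-vertexPairs _)) ⟩
    + 2 * sum² below
      ≡⟨ double (sum² below) ⟩
    sum² below + sum² below
      ≡⟨ cong (λ z → sum² below + z) (sum-comm below) ⟩
    sum² below + sum² (λ i j → below j i)
      ≡⟨ sum²-plus below (λ i j → below j i) ⟨
    sum² (λ i j → below i j + below j i)
      ≡⟨ sum²-cong split ⟩
    sum² (λ i j → ind (does (P? (i , j)))) ∎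
    where
    open ≡-Reasoning
    below : Fin n → Fin n → ℤ
    below i j = ind (does (i Fin.<? j)) * ind (does (P? (i , j)))
    double : ∀ x → + 2 * x ≡ x + x
    double = solve-∀
    split : ∀ i j → below i j + below j i ≡ ind (does (P? (i , j)))
    split i j with Fin.<-cmp i j
    ... | tri< i<j _ j≮i rewrite dec-true (i Fin.<? j) i<j | dec-false (j Fin.<? i) j≮i =
      trans (ℤ.+-identityʳ _) (ℤ.*-identityˡ _)
    ... | tri≈ _ refl _ rewrite P-irrefl i = cong₂ _+_ (ℤ.*-zeroʳ (ind (does (i Fin.<? i))))
        (ℤ.*-zeroʳ (ind (does (i Fin.<? i))))
    ... | tri> i≮j _ j<i rewrite dec-false (i Fin.<? j) i≮j | dec-true (j Fin.<? i) j<i | P-sym j i =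
      trans (ℤ.+-identityˡ _) (ℤ.*-identityˡ _)

  does-∈? : ∀ (i : Fin n) (S : Subset n) → does (i ∈? S) ≡ lookup S i
  does-∈? zero    (true ∷ S)  = refl
  does-∈? zero    (false ∷ S) = refl
  does-∈? (suc i) (b ∷ S)     = does-∈? i S

  add : Subset n → Fin n → Subset n
  add S x = S [ x ]≔ inside

  sumOver : Subset n → (Fin n → ℤ) → ℤ
  sumOver S f = sum λ i → ind (lookup S i) * f i

  sumOver-add : ∀ (S : Subset n) x f → lookup S x ≡ false → sumOver (add S x) f ≡ sumOver S f + f x
  sumOver-add (false ∷ S) zero f refl =
    trans (sum-suc _) (trans (lemma (f zero) _) (cong (_+ f zero) (sym (sum-suc _))))
    where
    lemma : ∀ x y → 1ℤ * x + y ≡ 0ℤ * x + y + x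
    lemma = solve-∀
  sumOver-add (b ∷ S) (suc x) f x∉ = trans (sum-suc _)
    (trans (cong (λ z → ind b * f zero + z) (sumOver-add S x (λ i → f (suc i)) x∉))
      (trans (sym (ℤ.+-assoc (ind b * f zero) _ _)) (cong (_+ f (suc x)) (sym (sum-suc _)))))

  sumOver-plus : ∀ (S : Subset n) f g → sumOver S (λ i → f i + g i) ≡ sumOver S f + sumOver S g
  sumOver-plus S f g = trans (sum-cong λ i → ℤ.*-distribˡ-+ (ind (lookup S i)) (f i) (g i))
      (sum-plus _ _)

  sumOver-empty : ∀ (f : Fin n → ℤ) → sumOver (replicate n false) f ≡ 0ℤ
  sumOver-empty {n} f = trans (sum-cong λ i → cong (λ b → ind b * f i) (lookup-replicate i false))
                              (trans (sum-const n 0ℤ) (ℤ.*-zeroʳ (+ n)))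

  card : ∀ (S : Subset n) → + ∣ S ∣ ≡ sum (λ i → ind (lookup S i))
  card []          = sym (sum-zero _)
  card (true ∷ S)  = trans (cong (λ z → 1ℤ + z) (card S)) (sym (sum-suc _))
  card (false ∷ S) = trans (card S) (trans (sym (ℤ.+-identityˡ _)) (sym (sum-suc _)))

  card-add : ∀ (S : Subset n) x → lookup S x ≡ false → ∣ add S x ∣ ≡ suc ∣ S ∣
  card-add (false ∷ S) zero    refl = refl
  card-add (true ∷ S)  (suc x) x∉   = cong suc (card-add S x x∉)
  card-add (false ∷ S) (suc x) x∉   = card-add S x x∉

  subsetSum : (Subset n → ℤ) → ℤ
  subsetSum {n} f = listSum f (allSubsets n)

  subsetSum-suc : ∀ (f : Subset (suc n) → ℤ) →
    subsetSum f ≡ subsetSum (λ S → f (false ∷ S)) + subsetSum (λ S → f (true ∷ S))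
  subsetSum-suc {n} f = trans (listSum-++ f (map (false ∷_) (allSubsets n)) _)
    (cong₂ _+_ (listSum-map f (false ∷_) (allSubsets n)) (listSum-map f (true ∷_) (allSubsets n)))

  subsetSum-zero : subsetSum {n} (λ _ → 0ℤ) ≡ 0ℤ
  subsetSum-zero {n} = listSum-zero (allSubsets n)

  subsetSum-cong : {f g : Subset n → ℤ} → (∀ S → f S ≡ g S) → subsetSum f ≡ subsetSum g
  subsetSum-cong {n} f≗g = listSum-cong f≗g (allSubsets n)

  -- S ↦ S ∪ {x} is a bijection from the sets avoiding x to those containing it.
  subsetSum-add : ∀ x (ψ : Subset n → ℤ) →
    subsetSum (λ S → ind (lookup S x) * ψ S) ≡ subsetSum (λ S → ind (not (lookup S x)) * ψ (add S x))
  subsetSum-add {suc n} zero ψ = trans (subsetSum-suc {n} _)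
    (trans (ℤ.+-comm (subsetSum {n} λ _ → 0ℤ) (subsetSum {n} λ S → 1ℤ * ψ (true ∷ S)))
           (sym (subsetSum-suc {n} _)))
  subsetSum-add {suc n} (suc x) ψ = trans (subsetSum-suc {n} _)
    (trans (cong₂ _+_ (subsetSum-add x (λ S → ψ (false ∷ S))) (subsetSum-add x (λ S → ψ (true ∷ S))))
           (sym (subsetSum-suc {n} _)))

  sizedSum : ℕ → (Subset n → ℤ) → ℤ
  sizedSum k φ = subsetSum λ S → ind (does (∣ S ∣ ℕ.≟ k)) * φ S

  sizedSum-zero : ∀ (φ : Subset n → ℤ) → sizedSum 0 φ ≡ φ (replicate n false)
  sizedSum-zero {zero}  φ = trans (ℤ.+-identityʳ _) (ℤ.*-identityˡ _)
  sizedSum-zero {suc n} φ = trans (subsetSum-suc {n} _)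
    (trans (cong₂ _+_ (sizedSum-zero (λ S → φ (false ∷ S))) (subsetSum-zero {n})) (ℤ.+-identityʳ _))

  *-ind-≟ : ∀ m k x → + k * (ind (does (m ℕ.≟ k)) * x) ≡ + m * (ind (does (m ℕ.≟ k)) * x)
  *-ind-≟ m k x with m ℕ.≡ᵇ k in eq
  ... | true  = cong (λ l → + l * (1ℤ * x)) (sym (ℕ.≡ᵇ⇒≡ m k (subst T (sym eq) _)))
  ... | false = trans (ℤ.*-zeroʳ (+ k)) (sym (ℤ.*-zeroʳ (+ m)))

  -- Double counting of pairs (S, x) with x ∈ S and S of size k + 1: each S occurs k + 1 times, and
  -- removing x leaves a k-set that avoids x.
  sizedSum-suc : ∀ k (φ : Subset n → ℤ) →
    + suc k * sizedSum (suc k) φ ≡ sum (λ x → sizedSum k (λ S → ind (not (lookup S x)) * φ (add S x)))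
  sizedSum-suc {n} k φ = begin
    + suc k * sizedSum (suc k) φ
      ≡⟨ listSum-*ˡ (+ suc k) _ (allSubsets n) ⟨
    subsetSum (λ S → + suc k * (ind (does (∣ S ∣ ℕ.≟ suc k)) * φ S))
      ≡⟨ subsetSum-cong (λ S → trans (*-ind-≟ ∣ S ∣ (suc k) (φ S)) (expand S)) ⟩
    subsetSum (λ S → sum (λ x → ind (lookup S x) * (ind (does (∣ S ∣ ℕ.≟ suc k)) * φ S)))
      ≡⟨ listSum-sum-comm _ (allSubsets n) ⟩
    sum (λ x → subsetSum (λ S → ind (lookup S x) * (ind (does (∣ S ∣ ℕ.≟ suc k)) * φ S)))
      ≡⟨ (sum-cong λ x → trans (subsetSum-add x _) (subsetSum-cong (shrink x))) ⟩
    sum (λ x → sizedSum k (λ S → ind (not (lookup S x)) * φ (add S x))) ∎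
    where
    open ≡-Reasoning
    expand : ∀ S → + ∣ S ∣ * (ind (does (∣ S ∣ ℕ.≟ suc k)) * φ S) ≡
                   sum (λ x → ind (lookup S x) * (ind (does (∣ S ∣ ℕ.≟ suc k)) * φ S))
    expand S = trans (cong (_* c) (card S)) (trans (ℤ.*-comm (sum (λ x → ind (lookup S x))) c)
        (trans (sym (sum-*ˡ c _)) (sum-cong λ x → ℤ.*-comm c _)))
      where c = ind (does (∣ S ∣ ℕ.≟ suc k)) * φ S
    shrink : ∀ x S → ind (not (lookup S x)) * (ind (does (∣ add S x ∣ ℕ.≟ suc k)) * φ (add S x)) ≡
                     ind (does (∣ S ∣ ℕ.≟ k)) * (ind (not (lookup S x)) * φ (add S x))
    shrink x S with lookup S x in eq
    ... | true  = sym (ℤ.*-zeroʳ (ind (does (∣ S ∣ ℕ.≟ k))))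
    ... | false rewrite card-add S x eq = trans (ℤ.*-identityˡ _)
        (cong (ind (does (∣ S ∣ ℕ.≟ k)) *_) (sym (ℤ.*-identityˡ _)))

  sumOver² : Subset n → (Fin n → Fin n → ℤ) → ℤ
  sumOver² S f = sumOver S λ i → sumOver S (f i)

  sumOver²-add : ∀ (S : Subset n) x f → (∀ i j → f i j ≡ f j i) → f x x ≡ 0ℤ → lookup S x ≡ false →
                 sumOver² (add S x) f ≡ sumOver² S f + + 2 * sumOver S (f x)
  sumOver²-add S x f f-sym fxx≡0 x∉ = begin
    sumOver² (add S x) f
      ≡⟨ sumOver-add S x _ x∉ ⟩
    sumOver S (λ i → sumOver (add S x) (f i)) + sumOver (add S x) (f x)
      ≡⟨ cong₂ _+_ (sum-cong λ i → cong (ind (lookup S i) *_) (sumOver-add S x (f i) x∉))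
          (sumOver-add S x (f x) x∉) ⟩
    sumOver S (λ i → sumOver S (f i) + f i x) + (sumOver S (f x) + f x x)
      ≡⟨ cong₂ _+_ (trans (sumOver-plus S _ _) (cong (λ z → sumOver² S f + z) (sum-cong λ i → cong
          (ind (lookup S i) *_) (f-sym i x))))
                   (trans (cong (λ z → sumOver S (f x) + z) fxx≡0) (ℤ.+-identityʳ _)) ⟩
    sumOver² S f + sumOver S (f x) + sumOver S (f x)
      ≡⟨ lemma (sumOver² S f) (sumOver S (f x)) ⟩
    sumOver² S f + + 2 * sumOver S (f x) ∎
    where
    open ≡-Reasoning
    lemma : ∀ a b → a + b + b ≡ a + + 2 * b
    lemma = solve-∀

  ∀-Bool? : {P : Bool → Set} → (∀ b → Dec (P b)) → Dec (∀ b → P b)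
  ∀-Bool? P? with P? true | P? false
  ... | yes t | yes f = yes λ { true → t ; false → f }
  ... | no ¬t | _     = no λ p → ¬t (p true)
  ... | yes _ | no ¬f = no λ p → ¬f (p false)

  sgn : Bool → ℤ
  sgn true  = 1ℤ
  sgn false = -1ℤ

  sgn-sign : ∀ b → IsSign (sgn b)
  sgn-sign true  = inj₁ refl
  sgn-sign false = inj₂ refl

  threeOfSixSigns-bound : ∀ a b c d e f →
    + 32 * ind (does (ind a + ind b + ind c + ind d + ind e + ind f ℤ.≟ + 3)) ≤
    threeOfSixSigns (sgn a) (sgn b) (sgn c) (sgn d) (sgn e) (sgn f)
  threeOfSixSigns-bound = toWitness {a? =
    ∀-Bool? λ a → ∀-Bool? λ b → ∀-Bool? λ c → ∀-Bool? λ d → ∀-Bool? λ e → ∀-Bool? λ f → _ ℤ.≤? _} _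

  module Count (G : Graph n) where

    e : Fin n → Fin n → ℤ
    e i j = ind (adj G i j)

    s : Fin n → Fin n → ℤ
    s i j = sgn (adj G i j)

    -- Doubling trades the count over increasing pairs for a symmetric sum over S × S, which splits
    -- when a vertex is added to S.
    2*edgesSpanned : ∀ S → + 2 * + edgesSpanned G S ≡ sumOver² S e
    2*edgesSpanned S = trans
      (double-length-vertexPairs (λ (i , j) → (i ∈? S) ×-dec (j ∈? S) ×-dec T? (adj G i j))
          symmetric irreflexive)
      (sum-cong λ i → trans (sum-cong λ j → split i j) (sum-*ˡ (ind (lookup S i))
          (λ j → ind (lookup S j) * e i j)))
      where
      split : ∀ i j → ind (does ((i ∈? S) ×-dec (j ∈? S) ×-dec T? (adj G i j))) ≡
                      ind (lookup S i) * (ind (lookup S j) * e i j)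
      split i j rewrite does-∈? i S | does-∈? j S =
        trans (ind-∧ (lookup S i) _) (cong (ind (lookup S i) *_) (ind-∧ (lookup S j) _))
      symmetric : ∀ i j → does ((i ∈? S) ×-dec (j ∈? S) ×-dec T? (adj G i j)) ≡ does
          ((j ∈? S) ×-dec (i ∈? S) ×-dec T? (adj G j i))
      symmetric i j rewrite does-∈? i S | does-∈? j S | sym-adj G i j = ∧-swap (lookup S i)
          (lookup S j) _
        where
        ∧-swap : ∀ a b c → a ∧ b ∧ c ≡ b ∧ a ∧ c
        ∧-swap true  true  c = refl
        ∧-swap true  false c = refl
        ∧-swap false true  c = refl
        ∧-swap false false c = refl
      irreflexive : ∀ i → does ((i ∈? S) ×-dec (i ∈? S) ×-dec T? (adj G i i)) ≡ false
      irreflexive i rewrite does-∈? i S | irrefl G i with lookup S i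
      ... | true  = refl
      ... | false = refl

    edgesSpanned-add : ∀ (S : Subset n) x → lookup S x ≡ false →
      + edgesSpanned G (add S x) ≡ + edgesSpanned G S + sumOver S (e x)
    edgesSpanned-add S x x∉ = ℤ.*-cancelˡ-≡ (+ 2) _ _ (begin
      + 2 * + edgesSpanned G (add S x)                ≡⟨ 2*edgesSpanned (add S x) ⟩
      sumOver² (add S x) e                            ≡⟨ sumOver²-add S x e e-sym
          (cong ind (irrefl G x)) x∉ ⟩
      sumOver² S e + + 2 * sumOver S (e x)            ≡⟨ cong (_+ + 2 * sumOver S (e x))
          (2*edgesSpanned S) ⟨
      + 2 * + edgesSpanned G S + + 2 * sumOver S (e x) ≡⟨ ℤ.*-distribˡ-+ (+ 2) (+ edgesSpanned G S) _ ⟨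
      + 2 * (+ edgesSpanned G S + sumOver S (e x))    ∎)
      where
      open ≡-Reasoning
      e-sym : ∀ i j → e i j ≡ e j i
      e-sym i j = cong ind (sym-adj G i j)

    edgesSpanned-empty : + edgesSpanned G (replicate n false) ≡ 0ℤ
    edgesSpanned-empty = ℤ.*-cancelˡ-≡ (+ 2) _ _ (trans (2*edgesSpanned (replicate n false))
        (sumOver-empty _))

    three : Fin n → Fin n → Fin n → Fin n → ℤ
    three a b c d = threeOfSixSigns (s a b) (s a c) (s a d) (s b c) (s b d) (s c d)

    spansThree : Subset n → ℤ
    spansThree S = ind (does (edgesSpanned G S ℕ.≟ 3))

    -- The set is built from the empty one by adding d, c, b, a in turn, and each vertex brings its
    -- edges to the earlier ones. The hypotheses say that each vertex is new, so all six pairs are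
    -- counted.
    spansThree-bound : ∀ a b c d → let S₁ = add (replicate n false) d; S₂ = add S₁ c; S₃ = add S₂ b in
      lookup S₁ c ≡ false → lookup S₂ b ≡ false → lookup S₃ a ≡ false →
      + 32 * spansThree (add S₃ a) ≤ three a b c d
    spansThree-bound a b c d c∉ b∉ a∉ =
      subst (λ E → + 32 * ind (does (E ℤ.≟ + 3)) ≤ three a b c d) (sym edges)
        (threeOfSixSigns-bound (adj G a b) (adj G a c) (adj G a d) (adj G b c) (adj G b d) (adj G c d))
      where
      S₀ = replicate n false
      S₁ = add S₀ d
      S₂ = add S₁ c
      S₃ = add S₂ b
      d∉ : lookup S₀ d ≡ false
      d∉ = lookup-replicate d false
      over₁ : ∀ f → sumOver S₁ f ≡ f d
      over₁ f = trans (sumOver-add S₀ d f d∉) (trans (cong (_+ f d) (sumOver-empty f))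
          (ℤ.+-identityˡ _))
      over₂ : ∀ f → sumOver S₂ f ≡ f d + f c
      over₂ f = trans (sumOver-add S₁ c f c∉) (cong (_+ f c) (over₁ f))
      over₃ : ∀ f → sumOver S₃ f ≡ f d + f c + f b
      over₃ f = trans (sumOver-add S₂ b f b∉) (cong (_+ f b) (over₂ f))
      edges : + edgesSpanned G (add S₃ a) ≡ e a b + e a c + e a d + e b c + e b d + e c d
      edges = trans (edgesSpanned-add S₃ a a∉) (trans (cong₂ _+_
        (trans (edgesSpanned-add S₂ b b∉) (cong₂ _+_
          (trans (edgesSpanned-add S₁ c c∉) (cong₂ _+_
            (trans (edgesSpanned-add S₀ d d∉) (cong₂ _+_ edgesSpanned-empty (sumOver-empty (e d))))
            (over₁ (e c))))
          (over₂ (e b))))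
        (over₃ (e a)))
        (lemma (e a b) (e a c) (e a d) (e b c) (e b d) (e c d)))
        where
        lemma : ∀ ab ac ad bc bd cd → 0ℤ + 0ℤ + cd + (bd + bc) + (ad + ac + ab) ≡ ab + ac + ad + bc
            + bd + cd
        lemma = solve-∀

    -- `sizedSum-suc` at k = 3, 2, 1, 0 yields the factor 4 · 3 · 2 · 1; its indicators restrict the
    -- sum to quadruples of distinct vertices.
    24*count : ∀ (φ : Subset n → ℤ) → + 24 * sizedSum 4 φ ≡
      sum⁴ (λ a b c d → let S₁ = add (replicate n false) d; S₂ = add S₁ c; S₃ = add S₂ b in
        ind (not (lookup (replicate n false) d)) * (ind (not (lookup S₁ c)) *
          (ind (not (lookup S₂ b)) * (ind (not (lookup S₃ a)) * φ (add S₃ a)))))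
    24*count φ = begin
      + 24 * sizedSum 4 φ
        ≡⟨ lemma (sizedSum 4 φ) ⟩
      + 6 * (+ 4 * sizedSum 4 φ)
        ≡⟨ trans (cong (+ 6 *_) (sizedSum-suc 3 φ)) (sym (sum-*ˡ (+ 6) _)) ⟩
      sum (λ a → + 6 * sizedSum 3 (φ₁ a))
        ≡⟨ (sum-cong λ a → trans (lemma₂ (sizedSum 3 (φ₁ a)))
            (trans (cong (+ 2 *_) (sizedSum-suc 2 (φ₁ a))) (sym (sum-*ˡ (+ 2) _)))) ⟩
      sum² (λ a b → + 2 * sizedSum 2 (φ₂ a b))
        ≡⟨ (sum²-cong λ a b → sizedSum-suc 1 (φ₂ a b)) ⟩
      sum² (λ a b → sum (λ c → sizedSum 1 (φ₃ a b c)))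
        ≡⟨ (sum²-cong λ a b → sum-cong λ c → trans (sym (ℤ.*-identityˡ _))
            (sizedSum-suc 0 (φ₃ a b c))) ⟩
      sum² (λ a b → sum² (λ c d → sizedSum 0 (φ₄ a b c d)))
        ≡⟨ (sum²-cong λ a b → sum²-cong λ c d → sizedSum-zero (φ₄ a b c d)) ⟩
      sum⁴ (λ a b c d → φ₄ a b c d (replicate n false)) ∎
      where
      open ≡-Reasoning
      lemma : ∀ x → + 24 * x ≡ + 6 * (+ 4 * x)
      lemma = solve-∀
      lemma₂ : ∀ x → + 6 * x ≡ + 2 * (+ 3 * x)
      lemma₂ = solve-∀
      φ₁ : Fin n → Subset n → ℤ
      φ₁ a S = ind (not (lookup S a)) * φ (add S a)
      φ₂ : Fin n → Fin n → Subset n → ℤ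
      φ₂ a b S = ind (not (lookup S b)) * φ₁ a (add S b)
      φ₃ : Fin n → Fin n → Fin n → Subset n → ℤ
      φ₃ a b c S = ind (not (lookup S c)) * φ₂ a b (add S c)
      φ₄ : Fin n → Fin n → Fin n → Fin n → Subset n → ℤ
      φ₄ a b c d S = ind (not (lookup S d)) * φ₃ a b c (add S d)

    three-nonNegative : ∀ a b c d → 0ℤ ≤ three a b c d
    three-nonNegative a b c d = ℤ.≤-trans 0≤
      (threeOfSixSigns-bound (adj G a b) (adj G a c) (adj G a d) (adj G b c) (adj G b d) (adj G c d))
      where
      0≤ : ∀ {x} → 0ℤ ≤ + 32 * ind x
      0≤ {true}  = ℤ.+≤+ ℕ.z≤n
      0≤ {false} = ℤ.+≤+ ℕ.z≤n

    #subsets≡ : + #subsetsSpanning 4 3 G ≡ sizedSum 4 spansThree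
    #subsets≡ = trans (length-filter _ (allSubsets n))
      (listSum-cong (λ S → ind-∧ (does (∣ S ∣ ℕ.≟ 4)) (does (edgesSpanned G S ℕ.≟ 3))) (allSubsets n))

    -- 768 = 24 · 32: each set has 24 orderings of weight 32. Quadruples with a repetition vanish on
    -- the left and are non-negative on the right, so they cause no error term.
    #subsets-bound : + 768 * + #subsetsSpanning 4 3 G ≤ sum⁴ three
    #subsets-bound = begin
      + 768 * + #subsetsSpanning 4 3 G
        ≡⟨ trans (cong (+ 768 *_) #subsets≡) (lemma (sizedSum 4 spansThree)) ⟩
      + 32 * (+ 24 * sizedSum 4 spansThree)
        ≡⟨ trans (cong (+ 32 *_) (24*count spansThree)) (sym (sum⁴-*ˡ (+ 32) _)) ⟩
      sum⁴ _
        ≤⟨ (sum²-mono λ a b → sum²-mono λ c d → avoiding (lookup (replicate n false) d) (λ _ →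
             avoiding (lookup (add (replicate n false) d) c) (λ c∉ →
             avoiding (lookup (add (add (replicate n false) d) c) b) (λ b∉ →
             avoiding (lookup (add (add (add (replicate n false) d) c) b) a) (λ a∉ →
             spansThree-bound a b c d c∉ b∉ a∉)
             (three-nonNegative a b c d)) (three-nonNegative a b c d)) (three-nonNegative a b c d))
                 (three-nonNegative a b c d)) ⟩
      sum⁴ three ∎
      where
      open ℤ.≤-Reasoning
      lemma : ∀ x → + 768 * x ≡ + 32 * (+ 24 * x)
      lemma = solve-∀
      avoiding : ∀ b {x y} → (b ≡ false → + 32 * x ≤ y) → 0ℤ ≤ y → + 32 * (ind (not b) * x) ≤ y
      avoiding true  _   0≤y = 0≤y
      avoiding false x≤y _   = subst (λ z → + 32 * z ≤ _) (sym (ℤ.*-identityˡ _)) (x≤y refl)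

-- Making the parts equal, and the resulting edit distance.

module Balancing where

  open import Defs
  open import Data.Bool.Base using (true; false; _xor_)
  open import Data.Bool.Properties using (T?)
  open import Data.Fin.Base using (Fin; zero; suc; toℕ; fromℕ; inject₁; punchIn; splitAt)
  import Data.Fin.Properties as Fin
  open import Data.Fin.Permutation as Perm using (Permutation; Permutation′; _⟨$⟩ʳ_; _⟨$⟩ˡ_; insert;
      insert-punchIn; lift₀; cast-id; _∘ₚ_; inverseˡ; inverseʳ)
  open import Data.Fin.Relation.Unary.Top using (view; ‵fromℕ; ‵inject₁)
  open import Data.Integer.Base as ℤ using (ℤ; +_; 0ℤ; 1ℤ; -1ℤ; _+_; _*_; _-_; _≤_)
  import Data.Integer.Properties as ℤ
  open import Data.Integer.Tactic.RingSolver using (solve-∀)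
  open import Data.Nat.Base as ℕ using (ℕ; zero; suc; _<ᵇ_; ⌊_/2⌋; ⌈_/2⌉)
  import Data.Nat.Properties as ℕ
  open import Data.Product.Base using (_×_; _,_; ∃; proj₁; proj₂)
  open import Data.Sum.Base using (_⊎_; inj₁; inj₂; [_,_]′)
  open import Relation.Binary.PropositionalEquality
  open import Relation.Nullary.Decidable using (yes; no)
  open import Relation.Nullary.Negation using (contradiction)
  open import Function.Base using (const)
  open SignPolynomials using (IsSign; sign²≡1)
  open Sums
  open Stability using (*-nonNegative; mismatch; sign-*; sign-triangle; sign-≤1)
  open Counting using (ind; sgn; sgn-sign; double-length-vertexPairs)

  private variable a b m n : ℕ

  step : ℕ → ℕ → ℤ
  step c k = sgn (k <ᵇ c)

  sum-step : ∀ {n c} → c ℕ.≤ n → sum {n} (λ j → step c (toℕ j)) ≡ + c - + (n ℕ.∸ c)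
  sum-step {zero} ℕ.z≤n = sum-zero _
  sum-step {suc n} {zero} ℕ.z≤n = trans (sum-const (suc n) -1ℤ) (trans (ℤ.*-comm (+ suc n) -1ℤ)
      (ℤ.-1*i≡-i (+ suc n)))
  sum-step {suc n} {suc c} (ℕ.s≤s c≤n) = trans (sum-suc _)
      (trans (cong (λ z → 1ℤ + z) (sum-step c≤n)) (sym (ℤ.+-assoc 1ℤ (+ c) (ℤ.- + (n ℕ.∸ c)))))

  -- `step c` lies below `step d`, so twice the indicator of their difference is a plain difference.
  -- The cost of moving the cut is thereby a difference of two sums.
  step-mono : ∀ {c d} → c ℕ.≤ d → ∀ k → 1ℤ - step c k * step d k ≡ step d k - step c k
  step-mono {zero}  {zero}  _ k       = refl
  step-mono {zero}  {suc d} _ zero    = refl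
  step-mono {zero}  {suc d} _ (suc k) = step-mono {zero} {d} ℕ.z≤n k
  step-mono (ℕ.s≤s c≤d) zero    = refl
  step-mono (ℕ.s≤s c≤d) (suc k) = step-mono c≤d k

  fromℕ-last : ∀ {n} (k : Fin n) → punchIn (fromℕ n) k ≡ inject₁ k
  fromℕ-last zero    = refl
  fromℕ-last (suc k) = cong suc (fromℕ-last k)

  insert-self : ∀ i j (π : Permutation m n) → insert i j π ⟨$⟩ʳ i ≡ j
  insert-self i j π with i Fin.≟ i
  ... | yes _  = refl
  ... | no i≢i = contradiction refl i≢i

  step-≥ : ∀ {c k} → c ℕ.≤ k → step c k ≡ -1ℤ
  step-≥ {zero}          _           = refl
  step-≥ {suc c} {suc k} (ℕ.s≤s c≤k) = step-≥ c≤k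

  -- By induction: a vertex of sign 1 goes to the front and one of sign -1 to the very end, so no
  -- position has to be searched for.
  sort : ∀ (p : Fin n → ℤ) → (∀ i → IsSign (p i)) →
         ∃ λ c → c ℕ.≤ n × ∃ λ (π : Permutation′ n) → ∀ j → p (π ⟨$⟩ʳ j) ≡ step c (toℕ j)
  sort {zero}  p p-sign = 0 , ℕ.z≤n , Perm.id , λ ()
  sort {suc n} p p-sign with sort (λ i → p (suc i)) (λ i → p-sign (suc i)) | p-sign zero
  ... | c , c≤n , π , sorted | inj₁ p₀≡1  = suc c , ℕ.s≤s c≤n , lift₀ π , λ where
    zero    → p₀≡1
    (suc j) → sorted j
  ... | c , c≤n , π , sorted | inj₂ p₀≡-1 = c , ℕ.m≤n⇒m≤1+n c≤n , ρ , at
    where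
    ρ = insert (fromℕ n) zero π
    at : ∀ j → p (ρ ⟨$⟩ʳ j) ≡ step c (toℕ j)
    at j with view j
    ... | ‵fromℕ = trans (cong p (insert-self (fromℕ n) zero π))
      (trans p₀≡-1 (sym (step-≥ (subst (c ℕ.≤_) (sym (Fin.toℕ-fromℕ n)) c≤n))))
    ... | ‵inject₁ k = begin
      p (ρ ⟨$⟩ʳ inject₁ k)              ≡⟨ cong (λ l → p (ρ ⟨$⟩ʳ l)) (fromℕ-last k) ⟨
      p (ρ ⟨$⟩ʳ punchIn (fromℕ n) k)    ≡⟨ cong p (insert-punchIn (fromℕ n) zero π k) ⟩
      p (suc (π ⟨$⟩ʳ k))                ≡⟨ sorted k ⟩
      step c (toℕ k)                    ≡⟨ cong (step c) (Fin.toℕ-inject₁ k) ⟨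
      step c (toℕ (inject₁ k))          ∎
      where open ≡-Reasoning

  sideSign : ∀ a → Fin (a ℕ.+ b) → ℤ
  sideSign a i = [ const 1ℤ , const -1ℤ ]′ (splitAt a i)

  sideSign≡step : ∀ a (i : Fin (a ℕ.+ b)) → sideSign a i ≡ step a (toℕ i)
  sideSign≡step zero    i       = refl
  sideSign≡step (suc a) zero    = refl
  sideSign≡step (suc a) (suc i) with splitAt a i | sideSign≡step a i
  ... | inj₁ _ | eq = eq
  ... | inj₂ _ | eq = eq

  sgn-bipartite : ∀ a b i j → sgn (adj (completeBipartite a b) i j) ≡ -1ℤ *
      (sideSign a i * sideSign a j)
  sgn-bipartite a b i j with splitAt a i | splitAt a j
  ... | inj₁ _ | inj₁ _ = refl
  ... | inj₁ _ | inj₂ _ = refl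
  ... | inj₂ _ | inj₁ _ = refl
  ... | inj₂ _ | inj₂ _ = refl

  sgn-cliques : ∀ a b i j → i ≢ j → sgn (adj (K a ⊎ᴳ K b) i j) ≡ 1ℤ * (sideSign a i * sideSign a j)
  sgn-cliques a b i j i≢j with splitAt a i in eqi | splitAt a j in eqj
  ... | inj₁ _ | inj₂ _ = refl
  ... | inj₂ _ | inj₁ _ = refl
  ... | inj₁ k | inj₁ l with k Fin.≟ l
  ...   | no  _    = refl
  ...   | yes refl = contradiction (trans (sym (Fin.splitAt⁻¹-↑ˡ eqi)) (Fin.splitAt⁻¹-↑ˡ eqj)) i≢j
  sgn-cliques a b i j i≢j | inj₂ k | inj₂ l with k Fin.≟ l
  ...   | no  _    = refl
  ...   | yes refl = contradiction (trans (sym (Fin.splitAt⁻¹-↑ʳ eqi)) (Fin.splitAt⁻¹-↑ʳ eqj)) i≢j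

  module _ (G G′ : Graph n) {σ} {p : Fin n → ℤ} (sσ : IsSign σ) (p-sign : ∀ i → IsSign (p i))
           (G′≡ : ∀ i j → i ≢ j → sgn (adj G′ i j) ≡ σ * (p i * p j)) where

    -- The 4 arises because each pair occurs in two orders and a disagreement contributes 2 to the
    -- mismatch. Diagonal terms only add to the right side, which is why `G′≡` is asked off the
    -- diagonal only.
    △-bound : + 4 * + ∣ G △ G′ ∣ ≤ mismatch (λ i j → sgn (adj G i j)) σ p
    △-bound = begin
      + 4 * + ∣ G △ G′ ∣
        ≡⟨ lemma (+ ∣ G △ G′ ∣) ⟩
      + 2 * (+ 2 * + ∣ G △ G′ ∣)
        ≡⟨ cong (+ 2 *_) (double-length-vertexPairs (λ (i , j) → T? (adj G i j xor adj G′ i j))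
             (λ i j → cong₂ _xor_ (sym-adj G i j) (sym-adj G′ i j))
             (λ i → cong₂ _xor_ (irrefl G i) (irrefl G′ i))) ⟩
      + 2 * sum² (λ i j → ind (adj G i j xor adj G′ i j))
        ≡⟨ sum²-*ˡ (+ 2) _ ⟨
      sum² (λ i j → + 2 * ind (adj G i j xor adj G′ i j))
        ≤⟨ sum²-mono pointwise ⟩
      mismatch (λ i j → sgn (adj G i j)) σ p ∎
      where
      open ℤ.≤-Reasoning
      lemma : ∀ x → + 4 * x ≡ + 2 * (+ 2 * x)
      lemma = solve-∀
      sgn-xor : ∀ x y → + 2 * ind (x xor y) ≡ 1ℤ - sgn x * sgn y
      sgn-xor true  true  = refl
      sgn-xor true  false = refl
      sgn-xor false true  = refl
      sgn-xor false false = refl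
      pointwise : ∀ i j → + 2 * ind (adj G i j xor adj G′ i j) ≤ 1ℤ - sgn (adj G i j) *
          (σ * (p i * p j))
      pointwise i j with i Fin.≟ j
      ... | no i≢j = ℤ.≤-reflexive (trans (sgn-xor (adj G i j) (adj G′ i j))
                       (cong (λ z → 1ℤ - sgn (adj G i j) * z) (G′≡ i j i≢j)))
      ... | yes refl rewrite irrefl G i | irrefl G′ i =
        ℤ.i≤j⇒0≤j-i (sign-≤1 (sign-* (inj₂ refl) (sign-* sσ (sign-* (p-sign i) (p-sign i)))))

  -- A pair (v,w) changes only if p and p′ differ at v or at w, hence the bound d(v) + d(w); each
  -- vertex counts in n rows and n columns.
  mismatch-change : ∀ {s : Fin n → Fin n → ℤ} {σ p p′} → (∀ i j → IsSign (s i j)) → IsSign σ →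
    (∀ i → IsSign (p i)) → (∀ i → IsSign (p′ i)) →
    mismatch s σ p′ ≤ mismatch s σ p + + 2 * (+ n * sum (λ i → 1ℤ - p i * p′ i))
  mismatch-change {n} {s} {σ} {p} {p′} s-sign sσ p-sign p′-sign = begin
    mismatch s σ p′
      ≤⟨ sum²-mono (λ v w → ℤ.≤-trans
           (sign-triangle (s-sign v w) (sign-* sσ (sign-* (p′-sign v) (p′-sign w)))
               (sign-* sσ (sign-* (p-sign v) (p-sign w))))
           (ℤ.+-monoʳ-≤ (1ℤ - s v w * (σ * (p v * p w))) (change v w))) ⟩
    sum² (λ v w → (1ℤ - s v w * (σ * (p v * p w))) + (d v + d w))
      ≡⟨ trans (sum²-plus _ _) (cong (λ z → mismatch s σ p + z) (sum²-plus _ _)) ⟩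
    mismatch s σ p + (sum² {n} {n} (λ v w → d v) + sum² {n} {n} (λ v w → d w))
      ≡⟨ cong (λ z → mismatch s σ p + z) (trans (cong₂ _+_ (trans (sum-cong λ v → sum-const n (d v))
          (sum-*ˡ (+ n) d)) (sum-const n (sum d))) (double (+ n * sum d))) ⟩
    mismatch s σ p + + 2 * (+ n * sum d) ∎
    where
    open ℤ.≤-Reasoning
    d : Fin n → ℤ
    d i = 1ℤ - p i * p′ i
    double : ∀ x → x + x ≡ + 2 * x
    double = solve-∀
    change : ∀ v w → 1ℤ - σ * (p v * p w) * (σ * (p′ v * p′ w)) ≤ d v + d w
    change v w = subst (_≤ d v + d w) (cong (λ z → 1ℤ - z) same)
      (subst₂ (λ x y → 1ℤ - p v * p′ v * (p w * p′ w) ≤ x + y) (cong (λ z → 1ℤ - z)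
          (ℤ.*-identityʳ (p v * p′ v))) (cong (λ z → 1ℤ - z) (ℤ.*-identityˡ (p w * p′ w)))
         (sign-triangle {p v * p′ v} {p w * p′ w} {1ℤ} (sign-* (p-sign v) (p′-sign v))
             (sign-* (p-sign w) (p′-sign w)) (inj₁ refl)))
      where
      lemma : ∀ a b c d σ → σ * σ * (a * b * (c * d)) ≡ σ * (a * c) * (σ * (b * d))
      lemma = solve-∀
      same : p v * p′ v * (p w * p′ w) ≡ σ * (p v * p w) * (σ * (p′ v * p′ w))
      same = trans (sym (ℤ.*-identityˡ _)) (trans (cong (_* (p v * p′ v * (p w * p′ w)))
          (sym (sign²≡1 sσ)))
        (lemma (p v) (p′ v) (p w) (p′ w) σ))

  2⌊n/2⌋-n≤1 : ∀ n {τ} → IsSign τ → τ * (+ ⌊ n /2⌋ - + (n ℕ.∸ ⌊ n /2⌋)) ≤ 1ℤ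
  2⌊n/2⌋-n≤1 n {τ} sτ = subst (λ k → τ * (+ ⌊ n /2⌋ - + k) ≤ 1ℤ)
    (sym (trans (cong (ℕ._∸ ⌊ n /2⌋) (sym (ℕ.⌊n/2⌋+⌈n/2⌉≡n n))) (ℕ.m+n∸m≡n ⌊ n /2⌋ ⌈ n /2⌉)))
        (halves n sτ)
    where
    halves : ∀ n {τ} → IsSign τ → τ * (+ ⌊ n /2⌋ - + ⌈ n /2⌉) ≤ 1ℤ
    halves zero          (inj₁ refl) = ℤ.+≤+ ℕ.z≤n
    halves zero          (inj₂ refl) = ℤ.+≤+ ℕ.z≤n
    halves (suc zero)    (inj₁ refl) = ℤ.-≤+
    halves (suc zero)    (inj₂ refl) = ℤ.≤-refl
    halves (suc (suc n)) {τ} sτ = subst (λ z → τ * z ≤ 1ℤ) (lemma (+ ⌊ n /2⌋) (+ ⌈ n /2⌉)) (halves n sτ)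
      where
      lemma : ∀ x y → x - y ≡ 1ℤ + x - (1ℤ + y)
      lemma = solve-∀

  cast-id-toℕ : ∀ (m≡n : m ≡ n) i → toℕ (cast-id m≡n ⟨$⟩ˡ i) ≡ toℕ i
  cast-id-toℕ m≡n i = Fin.toℕ-cast (sym m≡n) i

  module Balance {n} (p : Fin n → ℤ) (p-sign : ∀ i → IsSign (p i)) where

    private
      c = proj₁ (sort p p-sign)
      c≤n = proj₁ (proj₂ (sort p p-sign))
      π = proj₁ (proj₂ (proj₂ (sort p p-sign)))
      sorted = proj₂ (proj₂ (proj₂ (sort p p-sign)))

    balancing : m ≡ n → Permutation m n
    balancing m≡n = cast-id m≡n ∘ₚ π

    -- In the order given by π both p and p′ are step vectors, so they differ only between the two
    -- cuts.
    p′ : Fin n → ℤ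
    p′ i = step ⌊ n /2⌋ (toℕ (π ⟨$⟩ˡ i))

    p′-sign : ∀ i → IsSign (p′ i)
    p′-sign i = sgn-sign (toℕ (π ⟨$⟩ˡ i) <ᵇ ⌊ n /2⌋)

    sideSign≡p′ : ∀ (eq : ⌊ n /2⌋ ℕ.+ ⌈ n /2⌉ ≡ n) i → sideSign ⌊ n /2⌋ (balancing eq ⟨$⟩ˡ i) ≡ p′ i
    sideSign≡p′ eq i = trans (sideSign≡step ⌊ n /2⌋ _) (cong (step ⌊ n /2⌋) (cast-id-toℕ eq (π ⟨$⟩ˡ i)))

    private
      half : ℤ
      half = sum {n} (λ j → step ⌊ n /2⌋ (toℕ j))

      half≤1 : ∀ {τ} → IsSign τ → τ * half ≤ 1ℤ
      half≤1 {τ} sτ = subst (λ z → τ * z ≤ 1ℤ) (sym (sum-step (ℕ.⌊n/2⌋≤n n))) (2⌊n/2⌋-n≤1 n sτ)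

      total : sum p ≡ sum (λ j → step c (toℕ {n} j))
      total = trans (sum-permute p π) (sum-cong sorted)

      cost : sum (λ i → 1ℤ - p i * p′ i) ≡ sum (λ j → 1ℤ - step c (toℕ {n} j) * step ⌊ n /2⌋ (toℕ j))
      cost = trans (sum-permute (λ i → 1ℤ - p i * p′ i) π) (sum-cong λ j →
        cong₂ (λ x y → 1ℤ - x * y) (sorted j) (cong (λ k → step ⌊ n /2⌋ (toℕ k)) (inverseˡ π)))

    -- Nested steps differ by the difference of their sums; τ records which cut is larger. The 1
    -- covers odd n, where the balanced vector sums to -1.
    balancing-cost : ∃ λ τ → IsSign τ × sum (λ i → 1ℤ - p i * p′ i) ≤ 1ℤ + τ * sum p
    balancing-cost with ℕ.≤-total c ⌊ n /2⌋
    ... | inj₁ c≤h = -1ℤ , inj₂ refl , (begin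
      sum (λ i → 1ℤ - p i * p′ i)
        ≡⟨ cost ⟩
      sum (λ j → 1ℤ - step c (toℕ {n} j) * step ⌊ n /2⌋ (toℕ j))
        ≡⟨ trans (sum-cong λ j → step-mono c≤h (toℕ j)) (sum-minus _ _) ⟩
      half - sum (λ j → step c (toℕ {n} j))
        ≡⟨ lemma half _ ⟩
      1ℤ * half + -1ℤ * sum (λ j → step c (toℕ {n} j))
        ≤⟨ ℤ.+-mono-≤ (half≤1 (inj₁ refl)) (ℤ.≤-reflexive (cong (-1ℤ *_) (sym total))) ⟩
      1ℤ + -1ℤ * sum p ∎)
      where
      open ℤ.≤-Reasoning
      lemma : ∀ x y → x - y ≡ 1ℤ * x + -1ℤ * y
      lemma = solve-∀
    ... | inj₂ h≤c = 1ℤ , inj₁ refl , (begin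
      sum (λ i → 1ℤ - p i * p′ i)
        ≡⟨ cost ⟩
      sum (λ j → 1ℤ - step c (toℕ {n} j) * step ⌊ n /2⌋ (toℕ j))
        ≡⟨ trans (sum-cong λ j → trans (cong (λ z → 1ℤ - z) (ℤ.*-comm (step c (toℕ j)) _))
            (step-mono h≤c (toℕ j))) (sum-minus _ _) ⟩
      sum (λ j → step c (toℕ {n} j)) - half
        ≡⟨ lemma half _ ⟩
      -1ℤ * half + 1ℤ * sum (λ j → step c (toℕ {n} j))
        ≤⟨ ℤ.+-mono-≤ (half≤1 (inj₂ refl)) (ℤ.≤-reflexive (cong (1ℤ *_) (sym total))) ⟩
      1ℤ + 1ℤ * sum p ∎)
      where
      open ℤ.≤-Reasoning
      lemma : ∀ x y → y - x ≡ -1ℤ * x + 1ℤ * y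
      lemma = solve-∀

    module _ (G : Graph n) (R : Graph (⌊ n /2⌋ ℕ.+ ⌈ n /2⌉)) (eq : ⌊ n /2⌋ ℕ.+ ⌈ n /2⌉ ≡ n) {σ}
        (sσ : IsSign σ)
             (R≡ : ∀ i j → i ≢ j → sgn (adj R i j) ≡ σ * (sideSign ⌊ n /2⌋ i * sideSign ⌊ n /2⌋ j))
                 where

      s : Fin n → Fin n → ℤ
      s i j = sgn (adj G i j)

      editDistance-bound : + 4 * + editDistance G R eq ≤ mismatch s σ p′
      editDistance-bound = ℤ.≤-trans
        (ℤ.*-monoˡ-≤-nonNeg (+ 4) (ℤ.+≤+ (editDistance-lower G R eq (balancing eq))))
        (△-bound G (image (balancing eq) R) sσ p′-sign image≡)
        where
        image≡ : ∀ i j → i ≢ j → sgn (adj R (balancing eq ⟨$⟩ˡ i) (balancing eq ⟨$⟩ˡ j)) ≡ σ *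
            (p′ i * p′ j)
        image≡ i j i≢j = trans
          (R≡ _ _ λ fi≡fj → i≢j (trans (sym (inverseʳ (balancing eq)))
              (trans (cong (balancing eq ⟨$⟩ʳ_) fi≡fj) (inverseʳ (balancing eq)))))
          (cong₂ (λ x y → σ * (x * y)) (sideSign≡p′ eq i) (sideSign≡p′ eq j))

      editDistance-small : ∀ κ H {N} → N ≡ + n → H ≡ + 4 * (κ * κ) → 1ℤ ≤ κ → + 8 * κ ≤ N →
        H * mismatch s σ p ≤ + 3 * (N * N) → (∀ {τ} → IsSign τ → κ * (τ * sum p) ≤ N) →
        + 4 * (κ * + editDistance G R eq) ≤ + 3 * (N * N)
      editDistance-small κ H {N} refl refl 1≤κ 8κ≤N few balanced =
        ℤ.*-cancelˡ-≤-pos _ _ (+ 4 * κ) {{4κ>0}} (begin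
          + 4 * κ * (+ 4 * (κ * E))
            ≡⟨ lemma₁ κ E ⟩
          + 4 * (κ * κ) * (+ 4 * E)
            ≤⟨ ℤ.*-monoˡ-≤-nonNeg (+ 4 * (κ * κ)) {{ℤ.nonNegative 0≤4κ²}} (ℤ.≤-trans editDistance-bound
                 (mismatch-change {s = s} {σ} {p} {p′} (λ i j → sgn-sign (adj G i j)) sσ p-sign
                     p′-sign)) ⟩
          + 4 * (κ * κ) * (mismatch s σ p + + 2 * (N * d))
            ≡⟨ lemma₂ κ (mismatch s σ p) N d ⟩
          + 4 * (κ * κ) * mismatch s σ p + + 8 * κ * N * (κ * d)
            ≤⟨ ℤ.+-mono-≤ few (ℤ.*-monoˡ-≤-nonNeg (+ 8 * κ * N) {{ℤ.nonNegative 0≤8κN}} κd≤κ+N) ⟩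
          + 3 * (N * N) + + 8 * κ * N * (κ + N)
            ≡⟨ lemma₃ N κ ⟩
          + 3 * (N * N) * 1ℤ + κ * N * (+ 8 * κ) + + 8 * κ * N * N
            -- The terms become 3κN² + κN² + 8κN² = 12κN², that is 4κ times the target. The rounding
            -- to equal parts costs 8κ²N, which 8κ ≤ N turns into κN².
            ≤⟨ ℤ.+-monoˡ-≤ (+ 8 * κ * N * N) (ℤ.+-mono-≤
                 (ℤ.*-monoˡ-≤-nonNeg (+ 3 * (N * N)) {{ℤ.nonNegative (*-nonNegative {+ 3}
                     (ℤ.+≤+ ℕ.z≤n) (square-nonNegative N))}} 1≤κ)
                 (ℤ.*-monoˡ-≤-nonNeg (κ * N) {{ℤ.nonNegative 0≤κN}} 8κ≤N)) ⟩
          + 3 * (N * N) * κ + κ * N * N + + 8 * κ * N * N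
            ≡⟨ lemma₄ N κ ⟩
          + 4 * κ * (+ 3 * (N * N)) ∎)
        where
        open ℤ.≤-Reasoning
        E d : ℤ
        E = + editDistance G R eq
        d = sum (λ i → 1ℤ - p i * p′ i)
        0≤κ : 0ℤ ≤ κ
        0≤κ = ℤ.≤-trans (ℤ.+≤+ ℕ.z≤n) 1≤κ
        4κ>0 : ℤ.Positive (+ 4 * κ)
        4κ>0 = ℤ.positive (ℤ.<-≤-trans (ℤ.+<+ (ℕ.s≤s ℕ.z≤n)) (ℤ.*-monoˡ-≤-nonNeg (+ 4) 1≤κ))
        0≤4κ² : 0ℤ ≤ + 4 * (κ * κ)
        0≤4κ² = *-nonNegative {+ 4} (ℤ.+≤+ ℕ.z≤n) (square-nonNegative κ)
        0≤κN : 0ℤ ≤ κ * + n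
        0≤κN = *-nonNegative 0≤κ (ℤ.+≤+ ℕ.z≤n)
        0≤8κN : 0ℤ ≤ + 8 * κ * + n
        0≤8κN = *-nonNegative (*-nonNegative {+ 8} (ℤ.+≤+ ℕ.z≤n) 0≤κ) (ℤ.+≤+ ℕ.z≤n)
        κd≤κ+N : κ * d ≤ κ + + n
        κd≤κ+N = let τ , sτ , d≤ = balancing-cost in begin
          κ * d                    ≤⟨ ℤ.*-monoˡ-≤-nonNeg κ {{ℤ.nonNegative 0≤κ}} d≤ ⟩
          κ * (1ℤ + τ * sum p)     ≡⟨ trans (ℤ.*-distribˡ-+ κ 1ℤ _) (cong (_+ κ * (τ * sum p))
              (ℤ.*-identityʳ κ)) ⟩
          κ + κ * (τ * sum p)      ≤⟨ ℤ.+-monoʳ-≤ κ (balanced sτ) ⟩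
          κ + + n                  ∎
        lemma₁ : ∀ κ e → + 4 * κ * (+ 4 * (κ * e)) ≡ + 4 * (κ * κ) * (+ 4 * e)
        lemma₁ = solve-∀
        lemma₂ : ∀ κ m N d → + 4 * (κ * κ) * (m + + 2 * (N * d)) ≡ + 4 * (κ * κ) * m + + 8 * κ * N *
            (κ * d)
        lemma₂ = solve-∀
        lemma₃ : ∀ N κ → + 3 * (N * N) + + 8 * κ * N * (κ + N) ≡ + 3 * (N * N) * 1ℤ + κ * N *
            (+ 8 * κ) + + 8 * κ * N * N
        lemma₃ = solve-∀
        lemma₄ : ∀ N κ → + 3 * (N * N) * κ + κ * N * N + + 8 * κ * N * N ≡ + 4 * κ * (+ 3 * (N * N))
        lemma₄ = solve-∀

-- Binomial estimates, and the bounds on both moments from the density of 4-sets.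

module Estimates where

  open import Defs
  open import Data.Integer.Base as ℤ using (ℤ; +_; 0ℤ; 1ℤ; _+_; _*_; _-_; _≤_)
  import Data.Integer.Properties as ℤ
  open import Data.Integer.Tactic.RingSolver using (solve-∀)
  open import Data.Nat.Base as ℕ using (ℕ; zero; suc)
  open import Data.Nat.Combinatorics using (_C_; nCk+nC[k+1]≡[n+1]C[k+1]; nC1≡n; k>n⇒nCk≡0)
  import Data.Nat.Properties as ℕ
  import Data.Nat.Tactic.RingSolver as ℕSolver
  open import Relation.Binary.PropositionalEquality
  open Sums
  open Stability using (*-nonNegative)

  absorption : ∀ n k → suc k ℕ.* (suc n C suc k) ≡ suc n ℕ.* (n C k)
  absorption n zero = trans (ℕ.*-identityˡ _) (trans (nC1≡n (suc n)) (sym (ℕ.*-identityʳ (suc n))))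
  absorption zero (suc k) = trans (cong (suc (suc k) ℕ.*_) (k>n⇒nCk≡0 {1} {suc (suc k)}
      (ℕ.s≤s (ℕ.s≤s ℕ.z≤n))))
    (trans (ℕ.*-zeroʳ (suc (suc k))) (sym (trans (ℕ.*-identityˡ (0 C suc k)) (k>n⇒nCk≡0 {0} {suc k}
        (ℕ.s≤s ℕ.z≤n)))))
  absorption (suc n) (suc k) = begin
    (2 ℕ.+ k) ℕ.* (suc (suc n) C suc (suc k))
      ≡⟨ cong ((2 ℕ.+ k) ℕ.*_) (nCk+nC[k+1]≡[n+1]C[k+1] (suc n) (suc k)) ⟨
    (2 ℕ.+ k) ℕ.* (X ℕ.+ (suc n C suc (suc k)))
      ≡⟨ expand k X (suc n C suc (suc k)) ⟩
    X ℕ.+ (suc k ℕ.* X ℕ.+ suc (suc k) ℕ.* (suc n C suc (suc k)))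
      ≡⟨ cong (X ℕ.+_) (cong₂ ℕ._+_ (absorption n k) (absorption n (suc k))) ⟩
    X ℕ.+ (suc n ℕ.* (n C k) ℕ.+ suc n ℕ.* (n C suc k))
      ≡⟨ cong (X ℕ.+_) (ℕ.*-distribˡ-+ (suc n) (n C k) (n C suc k)) ⟨
    X ℕ.+ suc n ℕ.* ((n C k) ℕ.+ (n C suc k))
      ≡⟨ cong (λ z → X ℕ.+ suc n ℕ.* z) (nCk+nC[k+1]≡[n+1]C[k+1] n k) ⟩
    suc (suc n) ℕ.* X ∎
    where
    open ≡-Reasoning
    X = suc n C suc k
    expand : ∀ k x y → (2 ℕ.+ k) ℕ.* (x ℕ.+ y) ≡ x ℕ.+ ((1 ℕ.+ k) ℕ.* x ℕ.+ (2 ℕ.+ k) ℕ.* y)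
    expand = ℕSolver.solve-∀

  2*nC2 : ∀ n → 2 ℕ.* (suc n C 2) ≡ suc n ℕ.* n
  2*nC2 n = trans (absorption n 1) (cong (suc n ℕ.*_) (nC1≡n n))

  24*nC4 : ∀ r → 24 ℕ.* ((4 ℕ.+ r) C 4) ≡ (4 ℕ.+ r) ℕ.* ((3 ℕ.+ r) ℕ.* ((2 ℕ.+ r) ℕ.* (1 ℕ.+ r)))
  24*nC4 r = begin
    24 ℕ.* ((4 ℕ.+ r) C 4)                                ≡⟨ lemma₁ ((4 ℕ.+ r) C 4) ⟩
    6 ℕ.* (4 ℕ.* ((4 ℕ.+ r) C 4))                         ≡⟨ cong (6 ℕ.*_) (absorption (3 ℕ.+ r) 3) ⟩
    6 ℕ.* ((4 ℕ.+ r) ℕ.* ((3 ℕ.+ r) C 3))                 ≡⟨ lemma₂ (4 ℕ.+ r) ((3 ℕ.+ r) C 3) ⟩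
    (4 ℕ.+ r) ℕ.* (2 ℕ.* (3 ℕ.* ((3 ℕ.+ r) C 3)))         ≡⟨ cong (λ z → (4 ℕ.+ r) ℕ.* (2 ℕ.* z))
        (absorption (2 ℕ.+ r) 2) ⟩
    (4 ℕ.+ r) ℕ.* (2 ℕ.* ((3 ℕ.+ r) ℕ.* ((2 ℕ.+ r) C 2))) ≡⟨ cong ((4 ℕ.+ r) ℕ.*_)
        (lemma₃ (3 ℕ.+ r) ((2 ℕ.+ r) C 2)) ⟩
    (4 ℕ.+ r) ℕ.* ((3 ℕ.+ r) ℕ.* (2 ℕ.* ((2 ℕ.+ r) C 2))) ≡⟨ cong (λ z → (4 ℕ.+ r) ℕ.*
        ((3 ℕ.+ r) ℕ.* z)) (2*nC2 (1 ℕ.+ r)) ⟩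
    (4 ℕ.+ r) ℕ.* ((3 ℕ.+ r) ℕ.* ((2 ℕ.+ r) ℕ.* (1 ℕ.+ r))) ∎
    where
    open ≡-Reasoning
    lemma₁ : ∀ x → 24 ℕ.* x ≡ 6 ℕ.* (4 ℕ.* x)
    lemma₁ = ℕSolver.solve-∀
    lemma₂ : ∀ a x → 6 ℕ.* (a ℕ.* x) ≡ a ℕ.* (2 ℕ.* (3 ℕ.* x))
    lemma₂ = ℕSolver.solve-∀
    lemma₃ : ∀ a x → 2 ℕ.* (a ℕ.* x) ≡ a ℕ.* (2 ℕ.* x)
    lemma₃ = ℕSolver.solve-∀

  -- The gap is n(11n - 6), which for n = 4 + r is (4 + r)(38 + 11r), a product of non-negative
  -- factors.
  n⁴-6n³≤24*nC4 : ∀ r → let N = + (4 ℕ.+ r) in N * N * (N * N) - + 6 * (N * N * N) ≤ + 24 * +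
      ((4 ℕ.+ r) C 4)
  n⁴-6n³≤24*nC4 r = subst (N * N * (N * N) - + 6 * (N * N * N) ≤_) (sym expand)
    (ℤ.0≤i-j⇒j≤i (subst (0ℤ ≤_) (lemma (+ r)) (*-nonNegative {+ 4 + + r} (ℤ.+≤+ ℕ.z≤n)
      (ℤ.+-mono-≤ {0ℤ} {+ 38} (ℤ.+≤+ ℕ.z≤n) (*-nonNegative {+ 11} {+ r} (ℤ.+≤+ ℕ.z≤n) (ℤ.+≤+ ℕ.z≤n))))))
    where
    N = + (4 ℕ.+ r)
    expand : + 24 * + ((4 ℕ.+ r) C 4) ≡ (+ 4 + + r) * ((+ 3 + + r) * ((+ 2 + + r) * (+ 1 + + r)))
    expand = trans (sym (ℤ.pos-* 24 ((4 ℕ.+ r) C 4))) (trans (cong +_ (24*nC4 r))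
      (trans (ℤ.pos-* (4 ℕ.+ r) ((3 ℕ.+ r) ℕ.* ((2 ℕ.+ r) ℕ.* (1 ℕ.+ r)))) (cong (λ z → (+ 4 + + r) * z)
        (trans (ℤ.pos-* (3 ℕ.+ r) ((2 ℕ.+ r) ℕ.* (1 ℕ.+ r))) (cong (λ z → (+ 3 + + r) * z)
            (ℤ.pos-* (2 ℕ.+ r) (1 ℕ.+ r)))))))
    lemma : ∀ r → (+ 4 + r) * (+ 38 + + 11 * r) ≡
      (+ 4 + r) * ((+ 3 + r) * ((+ 2 + r) * (+ 1 + r))) -
      ((+ 4 + r) * (+ 4 + r) * ((+ 4 + r) * (+ 4 + r)) - + 6 * ((+ 4 + r) * (+ 4 + r) * (+ 4 + r)))
    lemma = solve-∀

  -- c is the number of all 4-sets, # that of the ones spanning 3 edges, and Θ is at least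
  -- 32 for each of the 24 orderings of the latter.
  Θ-defect : ∀ N M c # Θ → + 2 ≤ M → + 6 * M ≤ N → (M - + 2) * c ≤ + 2 * M * # → + 768 * # ≤ Θ →
    N * N * (N * N) - + 6 * (N * N * N) ≤ + 24 * c → M * (+ 16 * (N * N * (N * N)) - Θ) ≤ + 48 *
        (N * N * (N * N))
  Θ-defect N M c # Θ 2≤M 6M≤N hyp count choose = begin
    M * (+ 16 * (N * N * (N * N)) - Θ)
      ≡⟨ lemma₁ M N Θ ⟩
    + 16 * M * (N * N * (N * N)) - M * Θ
      ≤⟨ ℤ.+-monoʳ-≤ (+ 16 * M * (N * N * (N * N))) (ℤ.neg-mono-≤ lower) ⟩
    + 16 * M * (N * N * (N * N)) - + 16 * ((M - + 2) * (N * N * (N * N) - + 6 * (N * N * N)))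
      ≡⟨ lemma₂ M N ⟩
    + 32 * (N * N * (N * N)) + + 16 * (N * N * N) * (+ 6 * M) - + 192 * (N * N * N)
      -- 6M ≤ N turns the loss from the binomial estimate into 16N⁴; together with the 32N⁴ coming
      -- from δ this makes 48N⁴.
      ≤⟨ ℤ.+-mono-≤ (ℤ.+-monoʳ-≤ (+ 32 * (N * N * (N * N))) (ℤ.*-monoˡ-≤-nonNeg
          (+ 16 * (N * N * N)) {{ℤ.nonNegative (*-nonNegative {+ 16} (ℤ.+≤+ ℕ.z≤n) 0≤N³)}} 6M≤N))
           (ℤ.neg-mono-≤ (*-nonNegative {+ 192} (ℤ.+≤+ ℕ.z≤n) 0≤N³)) ⟩
    + 32 * (N * N * (N * N)) + + 16 * (N * N * N) * N - 0ℤ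
      ≡⟨ lemma₃ N ⟩
    + 48 * (N * N * (N * N)) ∎
    where
    open ℤ.≤-Reasoning
    0≤M : 0ℤ ≤ M
    0≤M = ℤ.≤-trans (ℤ.+≤+ ℕ.z≤n) 2≤M
    0≤N³ : 0ℤ ≤ N * N * N
    0≤N³ = *-nonNegative (*-nonNegative 0≤N 0≤N) 0≤N
      where
      0≤N : 0ℤ ≤ N
      0≤N = ℤ.≤-trans (*-nonNegative {+ 6} (ℤ.+≤+ ℕ.z≤n) 0≤M) 6M≤N
    lower : + 16 * ((M - + 2) * (N * N * (N * N) - + 6 * (N * N * N))) ≤ M * Θ
    lower = ℤ.*-cancelˡ-≤-pos (+ 16 * ((M - + 2) * (N * N * (N * N) - + 6 * (N * N * N)))) (M * Θ)
        (+ 2) (begin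
      + 2 * (+ 16 * ((M - + 2) * (N * N * (N * N) - + 6 * (N * N * N))))
        ≡⟨ lemma₄ (M - + 2) (N * N * (N * N) - + 6 * (N * N * N)) ⟩
      + 32 * (M - + 2) * (N * N * (N * N) - + 6 * (N * N * N))
        ≤⟨ ℤ.*-monoˡ-≤-nonNeg (+ 32 * (M - + 2)) {{ℤ.nonNegative (*-nonNegative {+ 32} (ℤ.+≤+ ℕ.z≤n)
            (ℤ.i≤j⇒0≤j-i 2≤M))}} choose ⟩
      + 32 * (M - + 2) * (+ 24 * c)
        ≡⟨ lemma₅ (M - + 2) c ⟩
      + 768 * ((M - + 2) * c)
        ≤⟨ ℤ.*-monoˡ-≤-nonNeg (+ 768) hyp ⟩
      + 768 * (+ 2 * M * #)
        ≡⟨ lemma₆ M # ⟩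
      + 2 * M * (+ 768 * #)
        ≤⟨ ℤ.*-monoˡ-≤-nonNeg (+ 2 * M) {{ℤ.nonNegative (*-nonNegative {+ 2} (ℤ.+≤+ ℕ.z≤n) 0≤M)}}
            count ⟩
      + 2 * M * Θ
        ≡⟨ ℤ.*-assoc (+ 2) M Θ ⟩
      + 2 * (M * Θ) ∎)
      where
      lemma₄ : ∀ x y → + 2 * (+ 16 * (x * y)) ≡ + 32 * x * y
      lemma₄ = solve-∀
      lemma₅ : ∀ x c → + 32 * x * (+ 24 * c) ≡ + 768 * (x * c)
      lemma₅ = solve-∀
      lemma₆ : ∀ M x → + 768 * (+ 2 * M * x) ≡ + 2 * M * (+ 768 * x)
      lemma₆ = solve-∀
    lemma₁ : ∀ M N Θ → M * (+ 16 * (N * N * (N * N)) - Θ) ≡ + 16 * M * (N * N * (N * N)) - M * Θ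
    lemma₁ = solve-∀
    lemma₂ : ∀ M N → + 16 * M * (N * N * (N * N)) - + 16 *
        ((M - + 2) * (N * N * (N * N) - + 6 * (N * N * N))) ≡
      + 32 * (N * N * (N * N)) + + 16 * (N * N * N) * (+ 6 * M) - + 192 * (N * N * N)
    lemma₂ = solve-∀
    lemma₃ : ∀ N → + 32 * (N * N * (N * N)) + + 16 * (N * N * N) * N - 0ℤ ≡ + 48 * (N * N * (N * N))
    lemma₃ = solve-∀

  module Bounds (N H S R² Θ β : ℤ) (0≤S : 0ℤ ≤ S) (0≤R² : 0ℤ ≤ R²) (N>0 : ℤ.Positive N) (1≤β : 1ℤ ≤ β)
    (flags : + 16 * S ≤ N * (N * (+ 16 * β * (N * (N * (N * (N * 1ℤ))) - R²) - β * Θ)))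
    (defect : + 3 * β * (H * H) * (+ 16 * (N * N * (N * N)) - Θ) ≤ + 48 * (N * N * (N * N))) where

    private
      N⁴ X Y : ℤ
      N⁴ = N * N * (N * N)
      X  = + 16 * N⁴ - Θ
      Y  = β * X - + 16 * β * R²

      0≤H² : 0ℤ ≤ H * H
      0≤H² = square-nonNegative H

      0≤N² : 0ℤ ≤ N * N
      0≤N² = square-nonNegative N

      0≤16β : 0ℤ ≤ + 16 * β
      0≤16β = *-nonNegative {+ 16} (ℤ.+≤+ ℕ.z≤n) (ℤ.≤-trans (ℤ.+≤+ ℕ.z≤n) 1≤β)

      defect′ : β * (H * H) * X ≤ + 16 * N⁴
      defect′ = ℤ.*-cancelˡ-≤-pos (β * (H * H) * X) (+ 16 * N⁴) (+ 3)
        (subst₂ _≤_ (lemma₁ β (H * H) X) (lemma₂ N⁴) defect)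
        where
        lemma₁ : ∀ β h x → + 3 * β * h * x ≡ + 3 * (β * h * x)
        lemma₁ = solve-∀
        lemma₂ : ∀ x → + 48 * x ≡ + 3 * (+ 16 * x)
        lemma₂ = solve-∀

      flags′ : + 16 * S ≤ N * (N * Y)
      flags′ = subst (+ 16 * S ≤_) (trans
          (cong (λ z → N * (N * (+ 16 * β * (N * (N * (N * z)) - R²) - β * Θ))) (ℤ.*-identityʳ N))
              (lemma N R² Θ β)) flags
        where
        lemma : ∀ N r t β → N * (N * (+ 16 * β * (N * (N * (N * N)) - r) - β * t)) ≡
                            N * (N * (β * (+ 16 * (N * N * (N * N)) - t) - + 16 * β * r))
        lemma = solve-∀

    -- Dropping the term with R² leaves 16S ≤ N²βX, and H²βX ≤ 16N⁴ by `defect′`.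
    S-bound : H * H * S ≤ N * (N * (N * N * (N * N)))
    S-bound = ℤ.*-cancelˡ-≤-pos (H * H * S) (N * (N * N⁴)) (+ 16) (begin
      + 16 * (H * H * S)
        ≡⟨ lemma₁ (H * H) S ⟩
      H * H * (+ 16 * S)
        ≤⟨ ℤ.*-monoˡ-≤-nonNeg (H * H) {{ℤ.nonNegative 0≤H²}} flags′ ⟩
      H * H * (N * (N * Y))
        ≡⟨ lemma₂ (H * H) N X R² β ⟩
      N * N * (β * (H * H) * X) - H * H * (N * N * (+ 16 * β * R²))
        ≤⟨ ℤ.+-mono-≤ (ℤ.*-monoˡ-≤-nonNeg (N * N) {{ℤ.nonNegative 0≤N²}} defect′)
             (ℤ.neg-mono-≤ (*-nonNegative 0≤H² (*-nonNegative 0≤N² (*-nonNegative 0≤16β 0≤R²)))) ⟩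
      N * N * (+ 16 * N⁴) - 0ℤ
        ≡⟨ lemma₃ N N⁴ ⟩
      + 16 * (N * (N * N⁴)) ∎)
      where
      open ℤ.≤-Reasoning
      lemma₁ : ∀ h s → + 16 * (h * s) ≡ h * (+ 16 * s)
      lemma₁ = solve-∀
      lemma₂ : ∀ h N x r β → h * (N * (N * (β * x - + 16 * β * r))) ≡
                             N * N * (β * h * x) - h * (N * N * (+ 16 * β * r))
      lemma₂ = solve-∀
      lemma₃ : ∀ N m → N * N * (+ 16 * m) - 0ℤ ≡ + 16 * (N * (N * m))
      lemma₃ = solve-∀

    -- S ≥ 0 makes the right side of the flag inequality non-negative, so 16βR² ≤ βX, and `defect′`
    -- applies again; β ≥ 1 removes the factor on the left.
    R²-bound : H * H * R² ≤ N * N * (N * N)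
    R²-bound = ℤ.*-cancelˡ-≤-pos (H * H * R²) N⁴ (+ 16) (begin
      + 16 * (H * H * R²)
        ≡⟨ ℤ.*-identityʳ _ ⟨
      + 16 * (H * H * R²) * 1ℤ
        ≤⟨ ℤ.*-monoˡ-≤-nonNeg (+ 16 * (H * H * R²)) {{ℤ.nonNegative (*-nonNegative {+ 16}
            (ℤ.+≤+ ℕ.z≤n) (*-nonNegative 0≤H² 0≤R²))}} 1≤β ⟩
      + 16 * (H * H * R²) * β
        ≡⟨ lemma₁ (H * H) R² β ⟩
      H * H * (+ 16 * β * R²)
        ≤⟨ ℤ.*-monoˡ-≤-nonNeg (H * H) {{ℤ.nonNegative 0≤H²}} (ℤ.0≤i-j⇒j≤i 0≤Y) ⟩
      H * H * (β * X)
        ≡⟨ lemma₂ (H * H) X β ⟩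
      β * (H * H) * X
        ≤⟨ defect′ ⟩
      + 16 * N⁴ ∎)
      where
      open ℤ.≤-Reasoning
      0≤Y : 0ℤ ≤ Y
      0≤Y = ℤ.*-cancelˡ-≤-pos 0ℤ Y N {{N>0}} (ℤ.*-cancelˡ-≤-pos (N * 0ℤ) (N * Y) N {{N>0}}
        (subst (_≤ N * (N * Y)) (sym (trans (cong (N *_) (ℤ.*-zeroʳ N)) (ℤ.*-zeroʳ N)))
          (ℤ.≤-trans (*-nonNegative {+ 16} (ℤ.+≤+ ℕ.z≤n) 0≤S) flags′)))
      lemma₁ : ∀ h r β → + 16 * (h * r) * β ≡ h * (+ 16 * β * r)
      lemma₁ = solve-∀
      lemma₂ : ∀ h x β → h * (β * x) ≡ β * h * x
      lemma₂ = solve-∀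

-- Assembling the argument over the integers.

module Closeness where

  open import Defs
  open import Data.Integer.Base as ℤ using (ℤ; +_; 1ℤ; _+_; _*_; _-_; _≤_)
  import Data.Integer.Properties as ℤ
  open import Data.Nat.Base as ℕ using (ℕ; suc; ⌊_/2⌋; ⌈_/2⌉)
  open import Data.Nat.Combinatorics using (_C_)
  import Data.Nat.Properties as ℕ
  open import Data.Product.Base using (proj₁; proj₂)
  open import Data.Sum.Base as Sum using (_⊎_; inj₁; inj₂)
  open import Relation.Binary.PropositionalEquality
  open SignPolynomials using (IsSign)
  open FlagInequality using (module Inequality)
  open Sums
  open Stability using (mismatch; module Structure)
  open Counting using (sgn; sgn-sign; module Count)
  open Balancing
  open Estimates

  positive-n : ∀ n .{{_ : ℕ.NonZero n}} → ℤ.Positive (+ n)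
  positive-n (suc n) = _

  module _ (n : ℕ) .{{n≢0 : ℕ.NonZero n}} (G : Graph n) where
    private
      N = + n
      module Γ = Count G
      sign = λ i j → sgn-sign (adj G i j)
      symm : ∀ i j → Γ.s i j ≡ Γ.s j i
      symm i j = cong sgn (sym-adj G i j)
      module I = Inequality Γ.s sign symm (λ i → cong sgn (irrefl G i))
      module St = Structure n Γ.s sign symm

      S R² Θ : ℤ
      S  = sum² (λ u v → St.C u v * St.C u v)
      R² = sum² Γ.s * sum² Γ.s
      Θ  = sum⁴ Γ.three

      E : (R : Graph (⌊ n /2⌋ ℕ.+ ⌈ n /2⌉)) → ℤ
      E R = + editDistance G R (ℕ.⌊n/2⌋+⌈n/2⌉≡n n)

    close : ∀ κ H M β → H ≡ + 4 * (κ * κ) → M ≡ + 3 * β * (H * H) → β ≡ + 2116 → 1ℤ ≤ β → 1ℤ ≤ κ → +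
        8 * κ ≤ N →
      + 2 ≤ M → + 6 * M ≤ N →
      N * N * (N * N) - + 6 * (N * N * N) ≤ + 24 * + (n C 4) →
      (M - + 2) * + (n C 4) ≤ + 2 * M * + #subsetsSpanning 4 3 G →
      (+ 4 * (κ * E (completeBipartite ⌊ n /2⌋ ⌈ n /2⌉)) ≤ + 3 * (N * N)) ⊎
      (+ 4 * (κ * E (K ⌊ n /2⌋ ⊎ᴳ K ⌈ n /2⌉)) ≤ + 3 * (N * N))
    close κ H M β H≡ M≡ β≡ 1≤β 1≤κ 8κ≤N 2≤M 6M≤N choose hyp = conclude σ p sσ p-sign few balanced
      where
      defect : + 3 * β * (H * H) * (+ 16 * (N * N * (N * N)) - Θ) ≤ + 48 * (N * N * (N * N))
      defect = subst (λ M → M * (+ 16 * (N * N * (N * N)) - Θ) ≤ + 48 * (N * N * (N * N))) M≡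
        (Θ-defect N M (+ (n C 4)) (+ #subsetsSpanning 4 3 G) Θ 2≤M 6M≤N hyp Γ.#subsets-bound choose)
      module B = Bounds N H S R² Θ β (sum-nonNegative λ u → sum-nonNegative λ v → square-nonNegative
          (St.C u v))
        (square-nonNegative (sum² Γ.s)) (positive-n n) 1≤β (I.cycle-inequality β≡) defect
      str = St.structure κ H H≡ B.S-bound B.R²-bound
      σ = proj₁ str
      p = proj₁ (proj₂ str)
      sσ = proj₁ (proj₂ (proj₂ str))
      p-sign = proj₁ (proj₂ (proj₂ (proj₂ str)))
      few = proj₁ (proj₂ (proj₂ (proj₂ (proj₂ str))))
      balanced : ∀ {τ} → IsSign τ → κ * (τ * sum p) ≤ N
      balanced = proj₂ (proj₂ (proj₂ (proj₂ (proj₂ str))))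
      conclude : ∀ σ p → IsSign σ → (∀ v → IsSign (p v)) → H * mismatch Γ.s σ p ≤ + 3 * (N * N) →
        (∀ {τ} → IsSign τ → κ * (τ * sum p) ≤ N) →
        (+ 4 * (κ * E (completeBipartite ⌊ n /2⌋ ⌈ n /2⌉)) ≤ + 3 * (N * N)) ⊎
        (+ 4 * (κ * E (K ⌊ n /2⌋ ⊎ᴳ K ⌈ n /2⌉)) ≤ + 3 * (N * N))
      conclude σ p (inj₂ refl) p-sign few balanced = inj₁
        (Balance.editDistance-small p p-sign G (completeBipartite ⌊ n /2⌋ ⌈ n /2⌉)
            (ℕ.⌊n/2⌋+⌈n/2⌉≡n n) (inj₂ refl)
          (λ i j _ → sgn-bipartite ⌊ n /2⌋ ⌈ n /2⌉ i j) κ H refl H≡ 1≤κ 8κ≤N few balanced)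
      conclude σ p (inj₁ refl) p-sign few balanced = inj₂
        (Balance.editDistance-small p p-sign G (K ⌊ n /2⌋ ⊎ᴳ K ⌈ n /2⌉) (ℕ.⌊n/2⌋+⌈n/2⌉≡n n) (inj₁ refl)
          (sgn-cliques ⌊ n /2⌋ ⌈ n /2⌉) κ H refl H≡ 1≤κ 8κ≤N few balanced)

-- Passage to rational numbers and choice of the constants.

open import Defs
open import Data.Nat.Base using (ℕ; ⌊_/2⌋; ⌈_/2⌉) renaming (_≤_ to _≤ℕ_)
open import Data.Nat.Combinatorics using (_C_)
open import Data.Nat.Properties using (⌊n/2⌋+⌈n/2⌉≡n)
open import Data.Integer.Base using (+_)
open import Data.Rational.Base using (ℚ; 0ℚ; ½; _/_; _<_; _≤_; _-_; _*_)
open import Data.Product.Base using (_×_; ∃-syntax)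
open import Data.Sum.Base using (_⊎_)

import Data.Integer.Base as ℤ
import Data.Integer.Properties as ℤ
open import Data.Integer.Tactic.RingSolver using (solve-∀)
import Data.Nat.Base as ℕ
open import Data.Nat.Base using (zero; suc)
import Data.Nat.Properties as ℕ
import Data.Rational.Base as ℚ
import Data.Rational.Properties as ℚ
open import Data.Rational.Base using (mkℚ; *<*)
import Data.Rational.Unnormalised.Base as ℚᵘ
open import Data.Rational.Unnormalised.Base using (mkℚᵘ; *≤*)
import Data.Rational.Unnormalised.Properties as ℚᵘ
open import Data.Product.Base using (_,_)
import Data.Sum.Base as Sum
open import Relation.Binary.PropositionalEquality
open Estimates using (n⁴-6n³≤24*nC4; 2*nC2)
open Closeness using (close)

toℚᵘ-/ : ∀ i n .{{_ : ℕ.NonZero n}} → ℚ.toℚᵘ (i / n) ℚᵘ.≃ i ℚᵘ./ n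
toℚᵘ-/ i (suc n) = ℚ.toℚᵘ-fromℚᵘ (mkℚᵘ i n)

½-1/M≤ : ∀ M c a .{{_ : ℕ.NonZero M}} .{{_ : ℕ.NonZero c}} →
  ½ - (+ 1 / M) ≤ + a / c → (+ M ℤ.- + 2) ℤ.* + c ℤ.≤ + 2 ℤ.* + M ℤ.* + a
½-1/M≤ M@(suc _) c@(suc _) a le = subst₂ ℤ._≤_ (lemma₁ (+ M) (+ c)) (lemma₂ (+ M) (+ a))
  (ℚᵘ.drop-*≤* (ℚᵘ.≤-respˡ-≃ lhs (ℚᵘ.≤-respʳ-≃ (toℚᵘ-/ (+ a) c) (ℚ.toℚᵘ-mono-≤ le))))
  where
  lhs : ℚ.toℚᵘ (½ - (+ 1 / M)) ℚᵘ.≃ mkℚᵘ (+ 1) 1 ℚᵘ.- (+ 1 ℚᵘ./ M)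
  lhs = ℚᵘ.≃-trans (ℚ.toℚᵘ-homo-+ ½ (ℚ.- (+ 1 / M))) (ℚᵘ.+-congʳ (mkℚᵘ (+ 1) 1)
    (ℚᵘ.≃-trans (ℚ.toℚᵘ-homo‿- (+ 1 / M)) (ℚᵘ.-‿cong (toℚᵘ-/ (+ 1) M))))
  lemma₁ : ∀ M c → (+ 1 ℤ.* M ℤ.+ (ℤ.- + 1) ℤ.* + 2) ℤ.* c ≡ (M ℤ.- + 2) ℤ.* c
  lemma₁ = solve-∀
  lemma₂ : ∀ M a → a ℤ.* (+ 2 ℤ.* M) ≡ + 2 ℤ.* M ℤ.* a
  lemma₂ = solve-∀

-- A positive rational has numerator at least 1, so ε is at least the reciprocal of its denominator,
-- and this denominator alone sets the precision.
/1≤ε* : ∀ ε → 0ℚ < ε → ∀ e x → + ℚ.↧ₙ ε ℤ.* + e ℤ.≤ + x → + e / 1 ≤ ε * (+ x / 1)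
/1≤ε* ε@(mkℚ (+ zero) _ _) (*<* (ℤ.+<+ ()))
/1≤ε* ε@(mkℚ ℤ.-[1+ _ ] _ _) (*<* ())
/1≤ε* ε@(mkℚ (+ suc a) d-1 _) 0<ε e x le = ℚ.toℚᵘ-cancel-≤
  (ℚᵘ.≤-respˡ-≃ (ℚᵘ.≃-sym (toℚᵘ-/ (+ e) 1)) (ℚᵘ.≤-respʳ-≃ (ℚᵘ.≃-sym rhs) (*≤* scaled)))
  where
  rhs : ℚ.toℚᵘ (ε * (+ x / 1)) ℚᵘ.≃ mkℚᵘ (+ suc a) d-1 ℚᵘ.* (+ x ℚᵘ./ 1)
  rhs = ℚᵘ.≃-trans (ℚ.toℚᵘ-homo-* ε (+ x / 1)) (ℚᵘ.*-congˡ {mkℚᵘ (+ suc a) d-1} (toℚᵘ-/ (+ x) 1))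
  scaled : + e ℤ.* + (suc d-1 ℕ.* 1) ℤ.≤ + suc a ℤ.* + x ℤ.* + 1
  scaled = begin
    + e ℤ.* + (suc d-1 ℕ.* 1)   ≡⟨ cong (λ d → + e ℤ.* + d) (ℕ.*-identityʳ (suc d-1)) ⟩
    + e ℤ.* + suc d-1           ≡⟨ ℤ.*-comm (+ e) (+ suc d-1) ⟩
    + suc d-1 ℤ.* + e           ≤⟨ le ⟩
    + x                         ≡⟨ ℤ.*-identityˡ (+ x) ⟨
    + 1 ℤ.* + x                 ≤⟨ ℤ.*-monoʳ-≤-nonNeg (+ x) {+ 1} {+ suc a} (ℤ.+≤+ (ℕ.s≤s ℕ.z≤n)) ⟩
    + suc a ℤ.* + x             ≡⟨ ℤ.*-identityʳ (+ suc a ℤ.* + x) ⟨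
    + suc a ℤ.* + x ℤ.* + 1     ∎
    where open ℤ.≤-Reasoning

-- For n ≥ 4, 3n² ≤ 4n² - 4n = 8·C(n,2). The matching 8 on the left is the reason for κ = 2m.
edit≤nC2 : ∀ n m e → 4 ≤ℕ n → + 4 ℤ.* (+ 2 ℤ.* m ℤ.* e) ℤ.≤ + 3 ℤ.* (+ n ℤ.* + n) → m ℤ.* e ℤ.≤ +
    (n C 2)
edit≤nC2 n@(suc n′) m e 4≤n le = ℤ.*-cancelˡ-≤-pos (m ℤ.* e) X (+ 8) (begin
  + 8 ℤ.* (m ℤ.* e)                         ≡⟨ lemma₁ m e ⟩
  + 4 ℤ.* (+ 2 ℤ.* m ℤ.* e)                 ≤⟨ le ⟩
  + 3 ℤ.* (N ℤ.* N)                         ≡⟨ lemma₂ N ⟩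
  + 4 ℤ.* (N ℤ.* N) ℤ.- N ℤ.* N             ≤⟨ ℤ.+-monoʳ-≤ (+ 4 ℤ.* (N ℤ.* N))
      (ℤ.neg-mono-≤ (ℤ.*-monoˡ-≤-nonNeg N (ℤ.+≤+ 4≤n))) ⟩
  + 4 ℤ.* (N ℤ.* N) ℤ.- N ℤ.* + 4           ≡⟨ lemma₃ (+ n′) ⟩
  + 4 ℤ.* (N ℤ.* + n′)                      ≡⟨ cong (+ 4 ℤ.*_) (trans (sym (ℤ.pos-* n n′))
      (trans (cong +_ (sym (2*nC2 n′))) (ℤ.pos-* 2 (n C 2)))) ⟩
  + 4 ℤ.* (+ 2 ℤ.* X)                       ≡⟨ lemma₄ X ⟩
  + 8 ℤ.* X                                 ∎)
  where
  open ℤ.≤-Reasoning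
  N = + n
  X = + (n C 2)
  lemma₁ : ∀ m e → + 8 ℤ.* (m ℤ.* e) ≡ + 4 ℤ.* (+ 2 ℤ.* m ℤ.* e)
  lemma₁ = solve-∀
  lemma₂ : ∀ N → + 3 ℤ.* (N ℤ.* N) ≡ + 4 ℤ.* (N ℤ.* N) ℤ.- N ℤ.* N
  lemma₂ = solve-∀
  lemma₃ : ∀ x → + 4 ℤ.* ((+ 1 ℤ.+ x) ℤ.* (+ 1 ℤ.+ x)) ℤ.- (+ 1 ℤ.+ x) ℤ.* + 4 ≡ + 4 ℤ.*
      ((+ 1 ℤ.+ x) ℤ.* x)
  lemma₃ = solve-∀
  lemma₄ : ∀ x → + 4 ℤ.* (+ 2 ℤ.* x) ≡ + 8 ℤ.* x
  lemma₄ = solve-∀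

module Constants (b : ℕ) (b≡ : + b ≡ + 2116) (1≤b : 1 ≤ℕ b) (m : ℕ) (1≤m : 1 ≤ℕ m) where

  -- The values of κ, H and M. In M the factor b cancels the weight of the certificate, h² supplies
  -- the precision for both second moments, and 3 reduces the 48 of `Θ-defect` to 16.
  k h M : ℕ
  k = 2 ℕ.* m
  h = 4 ℕ.* (k ℕ.* k)
  M = 3 ℕ.* b ℕ.* (h ℕ.* h)

  1≤k : 1 ≤ℕ k
  1≤k = ℕ.*-mono-≤ {1} {2} (ℕ.s≤s ℕ.z≤n) 1≤m

  1≤h : 1 ≤ℕ h
  1≤h = ℕ.*-mono-≤ {1} {4} (ℕ.s≤s ℕ.z≤n) (ℕ.*-mono-≤ 1≤k 1≤k)

  3≤M : 3 ≤ℕ M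
  3≤M = ℕ.*-mono-≤ (ℕ.*-monoʳ-≤ 3 1≤b) (ℕ.*-mono-≤ 1≤h 1≤h)

  M≢0 : ℕ.NonZero M
  M≢0 = ℕ.>-nonZero (ℕ.≤-trans (ℕ.s≤s ℕ.z≤n) 3≤M)

  h≡ : + h ≡ + 4 ℤ.* (+ 2 ℤ.* + m ℤ.* (+ 2 ℤ.* + m))
  h≡ = trans (ℤ.pos-* 4 (k ℕ.* k)) (cong (+ 4 ℤ.*_)
    (trans (ℤ.pos-* k k) (cong₂ ℤ._*_ (ℤ.pos-* 2 m) (ℤ.pos-* 2 m))))

  M≡ : + M ≡ + 3 ℤ.* + b ℤ.* (+ h ℤ.* + h)
  M≡ = trans (ℤ.pos-* (3 ℕ.* b) (h ℕ.* h)) (cong₂ ℤ._*_ (ℤ.pos-* 3 b) (ℤ.pos-* h h))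

  -- The first summand pays for repeated vertices in the count of 4-sets, the second for rounding
  -- the parts to equal size.
  n₀ : ℕ
  n₀ = 6 ℕ.* M ℕ.+ 8 ℕ.* k

  conclusion : ∀ n → n₀ ≤ℕ n → (4≤n : 4 ≤ℕ n) → (G : Graph n) → ½ - (_/_ (+ 1) M {{M≢0}}) ≤ Λ 4 3 G
      4≤n →
    (+ m ℤ.* + editDistance G (completeBipartite ⌊ n /2⌋ ⌈ n /2⌉) (⌊n/2⌋+⌈n/2⌉≡n n) ℤ.≤ + (n C 2)) ⊎
    (+ m ℤ.* + editDistance G (K ⌊ n /2⌋ ⊎ᴳ K ⌈ n /2⌉) (⌊n/2⌋+⌈n/2⌉≡n n) ℤ.≤ + (n C 2))
  conclusion n n₀≤n 4≤n G λ≥ = Sum.map (edit≤nC2 n (+ m) _ 4≤n) (edit≤nC2 n (+ m) _ 4≤n)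
    (close n {{ℕ.>-nonZero (ℕ.≤-trans (ℕ.s≤s ℕ.z≤n) 4≤n)}} G (+ 2 ℤ.* + m) (+ h) (+ M)
        (+ b) h≡ M≡ b≡ (ℤ.+≤+ 1≤b)
      (subst (+ 1 ℤ.≤_) (ℤ.pos-* 2 m) (ℤ.+≤+ 1≤k))
      (subst (ℤ._≤ + n) (trans (ℤ.pos-* 8 k) (cong (+ 8 ℤ.*_) (ℤ.pos-* 2 m)))
          (ℤ.+≤+ (ℕ.≤-trans (ℕ.m≤n+m (8 ℕ.* k) (6 ℕ.* M)) n₀≤n)))
      (ℤ.+≤+ (ℕ.≤-trans (ℕ.n≤1+n 2) 3≤M))
      (subst (ℤ._≤ + n) (ℤ.pos-* 6 M) (ℤ.+≤+ (ℕ.≤-trans (ℕ.m≤m+n (6 ℕ.* M) (8 ℕ.* k)) n₀≤n)))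
      (choose n 4≤n)
      (½-1/M≤ M (n C 4) (#subsetsSpanning 4 3 G) {{M≢0}} {{nCk≢0 4≤n}} λ≥))
    where
    choose : ∀ n → 4 ≤ℕ n → + n ℤ.* + n ℤ.* (+ n ℤ.* + n) ℤ.- + 6 ℤ.* (+ n ℤ.* + n ℤ.* + n) ℤ.≤ + 24
        ℤ.* + (n C 4)
    choose _ (ℕ.s≤s (ℕ.s≤s (ℕ.s≤s (ℕ.s≤s {n = r} ℕ.z≤n)))) = n⁴-6n³≤24*nC4 r

lemma4p1 : ∀ (ε : ℚ) → 0ℚ < ε →
    ∃[ δ ] (0ℚ < δ) × (∃[ n₀ ]
    (∀ (n : ℕ) → n₀ ≤ℕ n → (4≤n : 4 ≤ℕ n) → (G : Graph n) →
    ½ - δ ≤ Λ 4 3 G 4≤n →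
    (+ editDistance G (completeBipartite ⌊ n /2⌋ ⌈ n /2⌉) (⌊n/2⌋+⌈n/2⌉≡n n) / 1
    ≤ ε * (+ (n C 2) / 1))
    ⊎
    (+ editDistance G (K ⌊ n /2⌋ ⊎ᴳ K ⌈ n /2⌉) (⌊n/2⌋+⌈n/2⌉≡n n) / 1
    ≤ ε * (+ (n C 2) / 1))))
lemma4p1 ε 0<ε =
    -- With m the denominator of ε, M = 3 · 2116 · 256 · m⁴.
    _/_ (+ 1) M {{M≢0}}
  , ℚ.positive⁻¹ _ {{ℚ.normalize-pos 1 M {{M≢0}}}}
  , n₀
  , λ n n₀≤n 4≤n G λ≥ → Sum.map (/1≤ε* ε 0<ε _ _) (/1≤ε* ε 0<ε _ _) (conclusion n n₀≤n 4≤n G λ≥)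
  where open Constants 2116 refl (ℕ.s≤s ℕ.z≤n) (ℚ.↧ₙ ε) (ℕ.s≤s ℕ.z≤n)
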